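{- Let $\mathcal{S}\subseteq\mathcal{V}$ and $\mathcal{F}\subseteq\mathcal{V}^*$, with $\mathbf{D}=\mathbf{D}_{\mathcal{S}}$, $\overline{\mathbf{D}}=\mathbf{I}-\mathbf{D}$, $\mathbf{B}=\mathbf{B}_{\mathcal{F}}$, and suppose $\|\mathbf{B}\overline{\mathbf{D}}\|_2<1$. Then any band-limited signal $x\in\mathbb{C}^N$ (i.e. $\mathbf{B}x=x$) can be reconstructed from its sampled version $x_{\mathcal{S}}=\mathbf{D}x$ by the formula $$x=\sum_{i=1}^{|\mathcal{F}|}\frac{1}{\sigma_i^2}\,\langle x_{\mathcal{S}},\psi_i\rangle\,\psi_i,$$ where $\{\psi_i\}_{i=1,\dots,K}$ and $\{\sigma_i^2\}_{i=1,\dots,K}$, with $K=|\mathcal{F}|$, are the orthonormal band-limited eigenvectors of $\mathbf{B}\mathbf{D}\mathbf{B}$ and the corresponding eigenvalues, i.e. $\mathbf{B}\psi_i=\psi_i$ and $\mathbf{B}\mathbf{D}\mathbf{B}\psi_i=\sigma_i^2\psi_i$.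
   Context: $\mathcal{V}=\{1,\dots,N\}$ is the vertex set of a graph and $\mathcal{V}^*=\{1,\dots,N\}$ is the set of frequency indices. $\mathbf{U}\in\mathbb{C}^{N\times N}$ is a fixed arbitrary unitary matrix. For $\mathcal{S}\subseteq\mathcal{V}$, $\mathbf{D}_{\mathcal{S}}$ is the diagonal matrix whose $i$-th diagonal entry is $1$ if $i\in\mathcal{S}$ and $0$ otherwise. For $\mathcal{F}\subseteq\mathcal{V}^*$, $\mathbf{B}_{\mathcal{F}}=\mathbf{U}\mathbf{\Sigma}_{\mathcal{F}}\mathbf{U}^*$, where $\mathbf{\Sigma}_{\mathcal{F}}$ is the diagonal $0/1$ matrix with $i$-th diagonal entry $1$ if and only if $i\in\mathcal{F}$. $\|\cdot\|_2$ of a matrix is the spectral norm. The inner product is $\langle a,b\rangle=b^*a$ (linear in the first argument). -}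

module Defs where

open import Algebra.Bundles.Raw using (RawMonoid)
import Algebra.Definitions.RawMonoid as RawMonoidDefinitions
open import Data.Bool.Base using (if_then_else_)
open import Data.Fin.Base using (Fin)
open import Data.Fin.Properties renaming (_≟_ to _≟ᶠ_) using ()
open import Data.Fin.Subset using (Subset)
open import Data.Fin.Subset.Properties using (_∈?_)
import Data.Integer.Base as ℤ
open ℤ using (+_; +[1+_]; -[1+_])
import Data.Integer.Properties as ℤₚ
import Data.Nat.Base as ℕ
open ℕ using (ℕ; zero; suc)
import Data.Nat.DivMod as ℕ/
import Data.Nat.Properties as ℕₚ
open import Data.Nat.Tactic.RingSolver using (solve-∀)
open import Data.Product.Base using (_×_; _,_; ∃-syntax)
open import Data.Rational.Base hiding (_≃_)
open import Data.Rational.Properties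
import Data.Rational.Unnormalised.Base as ℚᵘ
import Data.Rational.Unnormalised.Properties as ℚᵘₚ
open import Data.Rational.Solver using (module +-*-Solver)
open import Data.Sum.Base using (inj₁; inj₂)
open import Level using (0ℓ)
open import Relation.Binary.PropositionalEquality
open import Relation.Nullary.Decidable.Core using (does; yes; no)
open import Relation.Nullary.Negation.Core using (contradiction)

module ℚ-Facts where
  ½-pos : ∀ {ε} → 0ℚ < ε → 0ℚ < ½ * ε
  ½-pos {ε} h = positive⁻¹ (½ * ε) {{pos*pos⇒pos ½ ε {{positive h}}}}

  *-pos : ∀ {p q} → 0ℚ < p → 0ℚ < q → 0ℚ < p * q
  *-pos {p} {q} hp hq =
    positive⁻¹ (p * q) {{pos*pos⇒pos p {{positive hp}} q {{positive hq}}}}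

  *-mono-≤₀ : ∀ {p q r s} → 0ℚ ≤ p → 0ℚ ≤ s → p ≤ q → r ≤ s → p * r ≤ q * s
  *-mono-≤₀ {p} {q} {r} {s} 0≤p 0≤s p≤q r≤s = ≤-trans
    (*-monoˡ-≤-nonNeg p {{nonNegative 0≤p}} r≤s)
    (*-monoʳ-≤-nonNeg s {{nonNegative 0≤s}} p≤q)

  ½+½ : ∀ ε → ½ * ε + ½ * ε ≡ ε
  ½+½ = solve 1 (λ e → con ½ :* e :+ con ½ :* e := e) refl
    where open +-*-Solver

  p<p+q : ∀ p {q} → 0ℚ < q → p < p + q
  p<p+q p {q} h = subst (_< p + q) (+-identityʳ p) (+-monoʳ-< p h)

  ∣p∣<q⇒ : ∀ {p q} → ∣ p ∣ < q → p < q
  ∣p∣<q⇒ {p} h with ≤-total 0ℚ p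
  ... | inj₁ 0≤p = subst (_< _) (0≤p⇒∣p∣≡p 0≤p) h
  ... | inj₂ p≤0 = ≤-<-trans (≤-trans p≤0 (0≤∣p∣ p)) h

  ∣p-q∣≡∣q-p∣ : ∀ p q → ∣ p - q ∣ ≡ ∣ q - p ∣
  ∣p-q∣≡∣q-p∣ p q = trans (sym (∣-p∣≡∣p∣ (p - q))) (cong ∣_∣
    (solve 2 (λ p q → :- (p :+ :- q) := q :+ :- p) refl p q))
    where open +-*-Solver

  ∣p-q∣≤ : ∀ p q {r} → p - q ≤ r → q - p ≤ r → ∣ p - q ∣ ≤ r
  ∣p-q∣≤ p q h₁ h₂ with ∣p∣≡p∨∣p∣≡-p (p - q)
  ... | inj₁ e = subst (_≤ _) (sym e) h₁
  ... | inj₂ e = subst (_≤ _) (sym (trans e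
    (solve 2 (λ p q → :- (p :+ :- q) := q :+ :- p) refl p q))) h₂
    where open +-*-Solver

  ∣∣p∣-∣q∣∣≤∣p-q∣ : ∀ p q → ∣ ∣ p ∣ - ∣ q ∣ ∣ ≤ ∣ p - q ∣
  ∣∣p∣-∣q∣∣≤∣p-q∣ p q =
    ∣p-q∣≤ ∣ p ∣ ∣ q ∣ (half p q) (subst (∣ q ∣ - ∣ p ∣ ≤_) (∣p-q∣≡∣q-p∣ q p) (half q p))
    where
    open +-*-Solver
    half : ∀ p q → ∣ p ∣ - ∣ q ∣ ≤ ∣ p - q ∣
    half p q = subst (∣ p ∣ - ∣ q ∣ ≤_)
      (solve 2 (λ a b → (a :+ b) :+ :- b := a) refl ∣ p - q ∣ ∣ q ∣)
      (+-monoˡ-≤ (- ∣ q ∣)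
        (subst (λ z → ∣ z ∣ ≤ ∣ p - q ∣ + ∣ q ∣)
          (solve 2 (λ p q → (p :+ :- q) :+ q := p) refl p q)
          (∣p+q∣≤∣p∣+∣q∣ (p - q) q)))

open ℚ-Facts

-- ℝ is the setoid of Cauchy sequences of rationals modulo null sequences. All
-- relations below are eventual ones, so a finite initial segment is irrelevant.

IsCauchy : (ℕ → ℚ) → Set
IsCauchy f = ∀ ε → 0ℚ < ε →
  ∃[ M ] (∀ m n → M ℕ.≤ m → M ℕ.≤ n → ∣ f m - f n ∣ < ε)

record ℝ : Set where
  constructor mkℝ
  field
    seq    : ℕ → ℚ
    cauchy : IsCauchy seq

open ℝ public

infix 4 _≈ℝ_ _≤ℝ_ _<ℝ_

_≈ℝ_ : ℝ → ℝ → Set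
x ≈ℝ y = ∀ ε → 0ℚ < ε → ∃[ M ] (∀ n → M ℕ.≤ n → ∣ seq x n - seq y n ∣ < ε)

_≤ℝ_ : ℝ → ℝ → Set
x ≤ℝ y = ∀ ε → 0ℚ < ε → ∃[ M ] (∀ n → M ℕ.≤ n → seq x n < seq y n + ε)

_<ℝ_ : ℝ → ℝ → Set
x <ℝ y = ∃[ ε ] (0ℚ < ε × ∃[ M ] (∀ n → M ℕ.≤ n → seq x n + ε < seq y n))

constℝ : ℚ → ℝ
constℝ q = mkℝ (λ _ → q) λ ε ε>0 → 0 , λ _ _ _ _ →
  subst (λ z → ∣ z ∣ < ε) (sym (+-inverseʳ q)) ε>0

0ℝ 1ℝ : ℝ
0ℝ = constℝ 0ℚ
1ℝ = constℝ 1ℚ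

infixl 6 _+ℝ_ _-ℝ_
infixl 7 _*ℝ_
infix  8 -ℝ_

_+ℝ_ : ℝ → ℝ → ℝ
mkℝ f cf +ℝ mkℝ g cg = mkℝ (λ n → f n + g n) cauchy+
  where
  open +-*-Solver
  cauchy+ : IsCauchy (λ n → f n + g n)
  cauchy+ ε ε>0 =
    let (M , hf) = cf (½ * ε) (½-pos ε>0)
        (L , hg) = cg (½ * ε) (½-pos ε>0)
    in M ℕ.⊔ L , λ m n m≥ n≥ → subst₂ _<_
         (cong ∣_∣ refl) (½+½ ε)
         (≤-<-trans
           (subst (λ z → ∣ z ∣ ≤ ∣ f m - f n ∣ + ∣ g m - g n ∣)
             (solve 4 (λ a b c d → (a :+ :- b) :+ (c :+ :- d)
                                := (a :+ c) :+ :- (b :+ d))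
               refl (f m) (f n) (g m) (g n))
             (∣p+q∣≤∣p∣+∣q∣ (f m - f n) (g m - g n)))
           (+-mono-<
             (hf m n (ℕₚ.m⊔n≤o⇒m≤o M L m≥) (ℕₚ.m⊔n≤o⇒m≤o M L n≥))
             (hg m n (ℕₚ.m⊔n≤o⇒n≤o M L m≥) (ℕₚ.m⊔n≤o⇒n≤o M L n≥))))

-ℝ_ : ℝ → ℝ
-ℝ mkℝ f cf = mkℝ (λ n → - f n) λ ε ε>0 →
  let (M , hf) = cf ε ε>0
  in M , λ m n m≥ n≥ → subst (_< ε)
       (trans (∣p-q∣≡∣q-p∣ (f m) (f n)) (cong ∣_∣
         (solve 2 (λ a b → b :+ :- a := :- a :+ :- (:- b)) refl (f m) (f n))))
       (hf m n m≥ n≥)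
  where open +-*-Solver

_-ℝ_ : ℝ → ℝ → ℝ
x -ℝ y = x +ℝ (-ℝ y)

-- Total, with the junk value invℚ 0ℚ = 0ℚ.
invℚ : ℚ → ℚ
invℚ q with q ≟ 0ℚ
... | yes _   = 0ℚ
... | no q≢0 = 1/_ q {{≢-nonZero q≢0}}

module Reciprocal-Facts where
  invℚ-inverse : ∀ {q} → 0ℚ < q → invℚ q * q ≡ 1ℚ
  invℚ-inverse {q} h with q ≟ 0ℚ
  ... | yes e  = contradiction (sym e) (<⇒≢ h)
  ... | no q≢0 = *-inverseˡ q {{≢-nonZero q≢0}}

  invℚ-pos : ∀ {q} → 0ℚ < q → 0ℚ < invℚ q
  invℚ-pos {q} h with q ≟ 0ℚ
  ... | yes e  = contradiction (sym e) (<⇒≢ h)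
  ... | no q≢0 = positive⁻¹ _ {{1/pos⇒pos q {{positive h}}}}

  0<1 : 0ℚ < 1ℚ
  0<1 = positive⁻¹ 1ℚ

  bounded : ∀ f → IsCauchy f →
    ∃[ b ] (0ℚ < b × ∃[ M ] (∀ n → M ℕ.≤ n → ∣ f n ∣ ≤ b))
  bounded f cf =
    let (M , h) = cf 1ℚ 0<1
    in 1ℚ + ∣ f M ∣ , +-mono-<-≤ 0<1 (0≤∣p∣ (f M)) , M , λ n n≥ →
         ≤-trans
           (subst (λ z → ∣ z ∣ ≤ ∣ f n - f M ∣ + ∣ f M ∣)
             (solve 2 (λ a b → (a :+ :- b) :+ b := a) refl (f n) (f M))
             (∣p+q∣≤∣p∣+∣q∣ (f n - f M) (f M)))
           (+-monoˡ-≤ ∣ f M ∣ (<⇒≤ (h n M n≥ ℕₚ.≤-refl)))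
    where open +-*-Solver

open Reciprocal-Facts

_*ℝ_ : ℝ → ℝ → ℝ
mkℝ f cf *ℝ mkℝ g cg = mkℝ (λ n → f n * g n) cauchy*
  where
  open +-*-Solver
  cauchy* : IsCauchy (λ n → f n * g n)
  cauchy* ε ε>0 =
    let (b , b>0 , Mb , hb) = bounded f cf
        (c , c>0 , Mc , hc) = bounded g cg
        δ₁ = invℚ b * (½ * ε)
        δ₂ = invℚ c * (½ * ε)
        δ₁>0 = *-pos (invℚ-pos b>0) (½-pos ε>0)
        δ₂>0 = *-pos (invℚ-pos c>0) (½-pos ε>0)
        (L₁ , hg) = cg δ₁ δ₁>0
        (L₂ , hf) = cf δ₂ δ₂>0
        K = (Mb ℕ.⊔ Mc) ℕ.⊔ (L₁ ℕ.⊔ L₂)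
        inMb = λ {n} (p : K ℕ.≤ n) → ℕₚ.m⊔n≤o⇒m≤o Mb Mc (ℕₚ.m⊔n≤o⇒m≤o (Mb ℕ.⊔ Mc) (L₁ ℕ.⊔ L₂) p)
        inMc = λ {n} (p : K ℕ.≤ n) → ℕₚ.m⊔n≤o⇒n≤o Mb Mc (ℕₚ.m⊔n≤o⇒m≤o (Mb ℕ.⊔ Mc) (L₁ ℕ.⊔ L₂) p)
        inL₁ = λ {n} (p : K ℕ.≤ n) → ℕₚ.m⊔n≤o⇒m≤o L₁ L₂ (ℕₚ.m⊔n≤o⇒n≤o (Mb ℕ.⊔ Mc) (L₁ ℕ.⊔ L₂) p)
        inL₂ = λ {n} (p : K ℕ.≤ n) → ℕₚ.m⊔n≤o⇒n≤o L₁ L₂ (ℕₚ.m⊔n≤o⇒n≤o (Mb ℕ.⊔ Mc) (L₁ ℕ.⊔ L₂) p)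
        cancel = λ {p} (p>0 : 0ℚ < p) → trans (sym (*-assoc p (invℚ p) (½ * ε)))
          (trans (cong (_* (½ * ε)) (trans (*-comm p (invℚ p)) (invℚ-inverse p>0)))
                 (*-identityˡ (½ * ε)))
        term = λ {p} (p>0 : 0ℚ < p) u v (u≤p : ∣ u ∣ ≤ p) (v< : ∣ v ∣ < invℚ p * (½ * ε)) →
          subst₂ _<_ (sym (∣p*q∣≡∣p∣*∣q∣ u v)) (cancel p>0)
            (≤-<-trans (*-monoʳ-≤-nonNeg ∣ v ∣ {{∣-∣-nonNeg v}} u≤p)
                       (*-monoʳ-<-pos p {{positive p>0}} v<))
    in K , λ m n m≥ n≥ → subst₂ _<_ refl (½+½ ε)
         (≤-<-trans
           (subst (λ z → ∣ z ∣ ≤ ∣ f m * (g m - g n) ∣ + ∣ g n * (f m - f n) ∣)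
             (solve 4 (λ a b c d → a :* (c :+ :- d) :+ d :* (a :+ :- b)
                                := a :* c :+ :- (b :* d))
               refl (f m) (f n) (g m) (g n))
             (∣p+q∣≤∣p∣+∣q∣ (f m * (g m - g n)) (g n * (f m - f n))))
           (+-mono-<
             (term b>0 (f m) (g m - g n) (hb m (inMb m≥)) (hg m n (inL₁ m≥) (inL₁ n≥)))
             (term c>0 (g n) (f m - f n) (hc n (inMc n≥)) (hf m n (inL₂ m≥) (inL₂ n≥)))))

recipℝ : (x : ℝ) → 0ℝ <ℝ x → ℝ
recipℝ (mkℝ f cf) (ε , ε>0 , M , f>ε) = mkℝ (λ n → invℚ (f n)) cauchy⁻¹
  where
  open +-*-Solver
  e : ℚ
  e = invℚ ε
  e>0 : 0ℚ < e
  e>0 = invℚ-pos ε>0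

  ε<f : ∀ n → M ℕ.≤ n → ε < f n
  ε<f n n≥ = subst (_< f n) (+-identityˡ ε) (f>ε n n≥)

  f>0 : ∀ n → M ℕ.≤ n → 0ℚ < f n
  f>0 n n≥ = <-trans ε>0 (ε<f n n≥)

  inv≤e : ∀ n → M ℕ.≤ n → invℚ (f n) ≤ e
  inv≤e n n≥ = subst₂ _≤_
    (trans (*-assoc u ε e) (trans (cong (u *_) (trans (*-comm ε e) (invℚ-inverse ε>0)))
      (*-identityʳ u)))
    (trans (cong (_* e) (invℚ-inverse (f>0 n n≥))) (*-identityˡ e))
    (*-monoʳ-≤-nonNeg e {{nonNegative (<⇒≤ e>0)}}
      (*-monoˡ-≤-nonNeg u {{nonNegative (<⇒≤ (invℚ-pos (f>0 n n≥)))}} (<⇒≤ (ε<f n n≥))))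
    where
    u : ℚ
    u = invℚ (f n)

  cauchy⁻¹ : IsCauchy (λ n → invℚ (f n))
  cauchy⁻¹ η η>0 =
    let δ = ε * ε * η
        (L , h) = cf δ (*-pos (*-pos ε>0 ε>0) η>0)
    in M ℕ.⊔ L , λ m n m≥ n≥ →
      let m≥M = ℕₚ.m⊔n≤o⇒m≤o M L m≥
          n≥M = ℕₚ.m⊔n≤o⇒m≤o M L n≥
          u = invℚ (f m)
          v = invℚ (f n)
          u>0 = invℚ-pos (f>0 m m≥M)
          v>0 = invℚ-pos (f>0 n n≥M)
          uv>0 = *-pos u>0 v>0
          diff : (u * v) * (f n - f m) ≡ u - v
          diff = trans
            (solve 4 (λ u v a b → (u :* v) :* (b :+ :- a) := u :* (v :* b) :+ :- (v :* (u :* a)))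
              refl u v (f m) (f n))
            (cong₂ (λ s t → s - t)
              (trans (cong (u *_) (invℚ-inverse (f>0 n n≥M))) (*-identityʳ u))
              (trans (cong (v *_) (invℚ-inverse (f>0 m m≥M))) (*-identityʳ v)))
          eeδ : (e * e) * δ ≡ η
          eeδ = trans
            (solve 3 (λ e d h → (e :* e) :* (d :* d :* h) := (e :* d) :* (e :* d) :* h) refl e ε η)
            (trans (cong (λ z → z * z * η) (invℚ-inverse ε>0))
                   (trans (cong (_* η) (*-identityˡ 1ℚ)) (*-identityˡ η)))
      in subst₂ _<_
           (trans (cong₂ _*_ (sym (0≤p⇒∣p∣≡p (<⇒≤ uv>0))) refl)
             (trans (sym (∣p*q∣≡∣p∣*∣q∣ (u * v) (f n - f m))) (cong ∣_∣ diff)))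
           eeδ
           (<-≤-trans
             (*-monoʳ-<-pos (u * v) {{positive uv>0}}
               (h n m (ℕₚ.m⊔n≤o⇒n≤o M L n≥) (ℕₚ.m⊔n≤o⇒n≤o M L m≥)))
             (*-monoʳ-≤-nonNeg δ {{nonNegative (<⇒≤ (*-pos (*-pos ε>0 ε>0) η>0))}}
               (*-mono-≤₀ (<⇒≤ u>0) (<⇒≤ e>0) (inv≤e m m≥M) (inv≤e n n≥M))))

-- Integer square root: the largest r with r * r ≤ n.
isqrt : ℕ → ℕ
isqrt zero    = 0
isqrt (suc n) with suc (isqrt n) ℕ.* suc (isqrt n) ℕₚ.≤? suc n
... | yes _ = suc (isqrt n)
... | no  _ = isqrt n

-- The largest multiple of 1 / suc n whose square is at most ∣ q ∣.
sqrtℚ : ℕ → ℚ → ℚ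
sqrtℚ n q = + isqrt (ℤ.∣ ↥ q ∣ ℕ.* (suc n ℕ.* suc n) ℕ./ ↧ₙ q) / suc n

module Sqrt-Facts where
  isqrt-lower : ∀ n → isqrt n ℕ.* isqrt n ℕ.≤ n
  isqrt-lower zero = ℕ.z≤n
  isqrt-lower (suc n) with suc (isqrt n) ℕ.* suc (isqrt n) ℕₚ.≤? suc n
  ... | yes p = p
  ... | no  _ = ℕₚ.m≤n⇒m≤1+n (isqrt-lower n)

  isqrt-upper : ∀ n → n ℕ.< suc (isqrt n) ℕ.* suc (isqrt n)
  isqrt-upper zero = ℕ.s≤s ℕ.z≤n
  isqrt-upper (suc n) with suc (isqrt n) ℕ.* suc (isqrt n) ℕₚ.≤? suc n
  ... | no ¬p = ℕₚ.≰⇒> ¬p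
  ... | yes _ = ℕₚ.≤-<-trans (isqrt-upper n)
    (ℕₚ.*-mono-< (ℕₚ.n<1+n (suc (isqrt n))) (ℕₚ.n<1+n (suc (isqrt n))))

  toℚᵘ-/ : ∀ k n → toℚᵘ (+ k / suc n) ℚᵘ.≃ ℚᵘ.mkℚᵘ (+ k) n
  toℚᵘ-/ k n = toℚᵘ-fromℚᵘ (ℚᵘ.mkℚᵘ (+ k) n)

  toℚᵘ-/² : ∀ k n → toℚᵘ ((+ k / suc n) * (+ k / suc n)) ℚᵘ.≃
                    ℚᵘ.mkℚᵘ (+ k) n ℚᵘ.* ℚᵘ.mkℚᵘ (+ k) n
  toℚᵘ-/² k n = ℚᵘₚ.≃-trans (toℚᵘ-homo-* (+ k / suc n) (+ k / suc n))
                             (ℚᵘₚ.*-cong (toℚᵘ-/ k n) (toℚᵘ-/ k n))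

  unit : ℕ → ℚ
  unit n = + 1 / suc n

  sqrtℚ-nonNeg : ∀ n q → 0ℚ ≤ sqrtℚ n q
  sqrtℚ-nonNeg n q = nonNegative⁻¹ _ 
    {{normalize-nonNeg (isqrt (ℤ.∣ ↥ q ∣ ℕ.* (suc n ℕ.* suc n) ℕ./ ↧ₙ q)) (suc n)}}

  unit-pos : ∀ n → 0ℚ < unit n
  unit-pos n = positive⁻¹ _ {{normalize-pos 1 (suc n)}}

  sqrtℚ+unit : ∀ k n → + k / suc n + unit n ≡ + suc k / suc n
  sqrtℚ+unit k n = toℚᵘ-injective (ℚᵘₚ.≃-trans (toℚᵘ-homo-+ (+ k / suc n) (unit n))
    (ℚᵘₚ.≃-trans (ℚᵘₚ.+-cong (toℚᵘ-/ k n) (toℚᵘ-/ 1 n))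
    (ℚᵘₚ.≃-trans (ℚᵘ.*≡* eq) (ℚᵘₚ.≃-sym (toℚᵘ-/ (suc k) n)))))
    where
    open ≡-Reasoning
    eqℕ : ∀ k m → (k ℕ.* m ℕ.+ 1 ℕ.* m) ℕ.* m ≡ (1 ℕ.+ k) ℕ.* (m ℕ.* m)
    eqℕ = solve-∀
    eq : (+ k ℤ.* + suc n ℤ.+ + 1 ℤ.* + suc n) ℤ.* + suc n ≡
         + suc k ℤ.* + (suc n ℕ.* suc n)
    eq = begin
      (+ k ℤ.* + suc n ℤ.+ + 1 ℤ.* + suc n) ℤ.* + suc n
        ≡⟨ cong₂ (λ a b → (a ℤ.+ b) ℤ.* + suc n) (sym (ℤₚ.pos-* k (suc n))) (sym (ℤₚ.pos-* 1 (suc n))) ⟩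
      (+ (k ℕ.* suc n ℕ.+ 1 ℕ.* suc n)) ℤ.* + suc n
        ≡⟨ sym (ℤₚ.pos-* (k ℕ.* suc n ℕ.+ 1 ℕ.* suc n) (suc n)) ⟩
      + ((k ℕ.* suc n ℕ.+ 1 ℕ.* suc n) ℕ.* suc n)
        ≡⟨ cong +_ (eqℕ k (suc n)) ⟩
      + (suc k ℕ.* (suc n ℕ.* suc n))
        ≡⟨ ℤₚ.pos-* (suc k) (suc n ℕ.* suc n) ⟩
      + suc k ℤ.* + (suc n ℕ.* suc n) ∎

  sqrtℚ-lower : ∀ n q → sqrtℚ n q * sqrtℚ n q ≤ ∣ q ∣
  sqrtℚ-lower n q@(mkℚ i d _) = toℚᵘ-cancel-≤
    (ℚᵘₚ.≤-respˡ-≃ (ℚᵘₚ.≃-sym (toℚᵘ-/² k n)) (ℚᵘ.*≤* le))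
    where
    a = ℤ.∣ i ∣ ℕ.* (suc n ℕ.* suc n)
    k = isqrt (a ℕ./ suc d)
    le : (+ k ℤ.* + k) ℤ.* + suc d ℤ.≤ + ℤ.∣ i ∣ ℤ.* + (suc n ℕ.* suc n)
    le = subst₂ ℤ._≤_
      (trans (ℤₚ.pos-* (k ℕ.* k) (suc d)) (cong (ℤ._* + suc d) (ℤₚ.pos-* k k)))
      (ℤₚ.pos-* ℤ.∣ i ∣ (suc n ℕ.* suc n))
      (ℤ.+≤+ (ℕₚ.≤-trans (ℕₚ.*-monoˡ-≤ (suc d) (isqrt-lower (a ℕ./ suc d)))
                          (ℕ/.m/n*n≤m a (suc d))))

  sqrtℚ-upper : ∀ n q → ∣ q ∣ < (sqrtℚ n q + unit n) * (sqrtℚ n q + unit n)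
  sqrtℚ-upper n q@(mkℚ i d _) = subst (λ z → ∣ q ∣ < z * z) (sym (sqrtℚ+unit k n))
    (toℚᵘ-cancel-< (ℚᵘₚ.<-respʳ-≃ (ℚᵘₚ.≃-sym (toℚᵘ-/² (suc k) n)) (ℚᵘ.*<* lt)))
    where
    a = ℤ.∣ i ∣ ℕ.* (suc n ℕ.* suc n)
    k = isqrt (a ℕ./ suc d)
    a< : a ℕ.< suc (a ℕ./ suc d) ℕ.* suc d
    a< = subst (ℕ._< suc (a ℕ./ suc d) ℕ.* suc d) (sym (ℕ/.m≡m%n+[m/n]*n a (suc d)))
      (ℕₚ.+-monoˡ-< (a ℕ./ suc d ℕ.* suc d) (ℕ/.m%n<n a (suc d)))
    lt : + ℤ.∣ i ∣ ℤ.* + (suc n ℕ.* suc n) ℤ.< (+ suc k ℤ.* + suc k) ℤ.* + suc d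
    lt = subst₂ ℤ._<_
      (ℤₚ.pos-* ℤ.∣ i ∣ (suc n ℕ.* suc n))
      (trans (ℤₚ.pos-* (suc k ℕ.* suc k) (suc d)) (cong (ℤ._* + suc d) (ℤₚ.pos-* (suc k) (suc k))))
      (ℤ.+<+ (ℕₚ.<-≤-trans a< (ℕₚ.*-monoˡ-≤ (suc d) (isqrt-upper (a ℕ./ suc d)))))

  unit-small : ∀ ε → 0ℚ < ε → ∃[ M ] (∀ n → M ℕ.≤ n → unit n ≤ ε)
  unit-small (mkℚ (+ 0) _ _) (*<* (ℤ.+<+ ()))
  unit-small (mkℚ -[1+ _ ] _ _) (*<* ())
  unit-small ε@(mkℚ +[1+ p ] d _) _ = d , λ n n≥ → toℚᵘ-cancel-≤
    (ℚᵘₚ.≤-respˡ-≃ (ℚᵘₚ.≃-sym (toℚᵘ-/ 1 n)) (ℚᵘ.*≤* (subst₂ ℤ._≤_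
      (ℤₚ.pos-* 1 (suc d)) (ℤₚ.pos-* (suc p) (suc n))
      (ℤ.+≤+ (ℕₚ.*-mono-≤ {1} {suc p} (ℕ.s≤s ℕ.z≤n) (ℕ.s≤s n≥))))))

  sqrtℚ-close : ∀ {m n p q ε} → 0ℚ < ε → ∣ p - q ∣ < ε * ε → unit n ≤ ε →
    sqrtℚ m p - sqrtℚ n q ≤ ε + ε
  sqrtℚ-close {m} {n} {p} {q} {ε} ε>0 pq< n≤ε = ≮⇒≥ λ lt →
    let b+2ε<a = subst₂ _<_
          (solve 2 (λ e b → (e :+ e) :+ b := (b :+ e) :+ e) refl ε b)
          (solve 2 (λ a b → (a :+ :- b) :+ b := a) refl a b)
          (+-monoˡ-< b lt)
        c+ε≤a = ≤-trans (+-monoˡ-≤ ε (+-monoʳ-≤ b n≤ε)) (<⇒≤ b+2ε<a)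
        c²+ε²≤ = subst (c * c + ε * ε ≤_)
          (solve 2 (λ c e → (c :* c :+ e :* e) :+ con (1ℚ + 1ℚ) :* (c :* e) := (c :+ e) :* (c :+ e))
            refl c ε)
          (subst (_≤ (c * c + ε * ε) + (1ℚ + 1ℚ) * (c * ε)) (+-identityʳ (c * c + ε * ε))
            (+-monoʳ-≤ (c * c + ε * ε) (<⇒≤ (*-pos {1ℚ + 1ℚ} (positive⁻¹ (1ℚ + 1ℚ)) (*-pos c>0 ε>0)))))
        sq≤ = ≤-trans (*-mono-≤₀ c+ε≥0 a≥0 c+ε≤a c+ε≤a) (sqrtℚ-lower m p)
        ∣q∣+ε²<∣p∣ = <-≤-trans (+-monoˡ-< (ε * ε) (sqrtℚ-upper n q)) (≤-trans c²+ε²≤ sq≤)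
        ε²<diff = subst (_< ∣ p ∣ - ∣ q ∣)
          (solve 2 (λ a b → (a :+ b) :+ :- a := b) refl ∣ q ∣ (ε * ε))
          (+-monoˡ-< (- ∣ q ∣) ∣q∣+ε²<∣p∣)
        diff<ε² = ∣p∣<q⇒ (≤-<-trans (∣∣p∣-∣q∣∣≤∣p-q∣ p q) pq<)
    in <-asym ε²<diff diff<ε²
    where
    open +-*-Solver
    a b c : ℚ
    a = sqrtℚ m p
    b = sqrtℚ n q
    c = b + unit n
    c>0 : 0ℚ < c
    c>0 = +-mono-≤-< (sqrtℚ-nonNeg n q) (unit-pos n)
    a≥0 : 0ℚ ≤ a
    a≥0 = sqrtℚ-nonNeg m p
    c+ε≥0 : 0ℚ ≤ c + ε
    c+ε≥0 = <⇒≤ (+-mono-< c>0 ε>0)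

open Sqrt-Facts

-- The square root of ∣ x ∣; used only for x ≥ 0.
sqrtℝ : ℝ → ℝ
sqrtℝ (mkℝ f cf) = mkℝ (λ n → sqrtℚ n (f n)) cauchy√
  where
  cauchy√ : IsCauchy (λ n → sqrtℚ n (f n))
  cauchy√ η η>0 =
    let ε = ½ * (½ * η)
        ε>0 = ½-pos (½-pos η>0)
        (M , h) = cf (ε * ε) (*-pos ε>0 ε>0)
        (L , u) = unit-small ε ε>0
        2ε<η : ε + ε < η
        2ε<η = subst₂ _<_ (sym (½+½ (½ * η))) (½+½ η) (p<p+q (½ * η) (½-pos η>0))
    in M ℕ.⊔ L , λ m n m≥ n≥ →
      let m≥M = ℕₚ.m⊔n≤o⇒m≤o M L m≥
          n≥M = ℕₚ.m⊔n≤o⇒m≤o M L n≥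
      in ≤-<-trans
           (∣p-q∣≤ (sqrtℚ m (f m)) (sqrtℚ n (f n))
             (sqrtℚ-close {m} {n} {f m} {f n} ε>0 (h m n m≥M n≥M) (u n (ℕₚ.m⊔n≤o⇒n≤o M L n≥)))
             (sqrtℚ-close {n} {m} {f n} {f m} ε>0 (h n m n≥M m≥M) (u m (ℕₚ.m⊔n≤o⇒n≤o M L m≥))))
           2ε<η

ℝ-+-rawMonoid : RawMonoid 0ℓ 0ℓ
ℝ-+-rawMonoid = record { Carrier = ℝ ; _≈_ = _≈ℝ_ ; _∙_ = _+ℝ_ ; ε = 0ℝ }

open RawMonoidDefinitions ℝ-+-rawMonoid public using () renaming (sum to ∑ℝ)

IsSupremum : (ℝ → Set) → ℝ → Set
IsSupremum P s = (∀ t → P t → t ≤ℝ s) × (∀ u → (∀ t → P t → t ≤ℝ u) → s ≤ℝ u)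

infixl 6 _+i_
record ℂ : Set where
  constructor _+i_
  field
    re im : ℝ

open ℂ public

infix  4 _≈ℂ_
infixl 6 _+ℂ_ _-ℂ_
infixl 7 _*ℂ_

_≈ℂ_ : ℂ → ℂ → Set
w ≈ℂ z = re w ≈ℝ re z × im w ≈ℝ im z

0ℂ 1ℂ : ℂ
0ℂ = 0ℝ +i 0ℝ
1ℂ = 1ℝ +i 0ℝ

_+ℂ_ _-ℂ_ _*ℂ_ : ℂ → ℂ → ℂ
w +ℂ z = (re w +ℝ re z) +i (im w +ℝ im z)
w -ℂ z = (re w -ℝ re z) +i (im w -ℝ im z)
w *ℂ z = (re w *ℝ re z -ℝ im w *ℝ im z) +i (re w *ℝ im z +ℝ im w *ℝ re z)

conj : ℂ → ℂ
conj z = re z +i (-ℝ im z)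

∣_∣² : ℂ → ℝ
∣ z ∣² = re z *ℝ re z +ℝ im z *ℝ im z

-- "z ≠ 0" in the positive (apartness) form needed to divide by z.
NonZeroℂ : ℂ → Set
NonZeroℂ z = 0ℝ <ℝ ∣ z ∣²

-- 1 / z = conj z / ∣ z ∣²
recipℂ : (z : ℂ) → NonZeroℂ z → ℂ
recipℂ z z≠0 = (re z *ℝ r) +i ((-ℝ im z) *ℝ r)
  where r = recipℝ ∣ z ∣² z≠0

ℂ-+-rawMonoid : RawMonoid 0ℓ 0ℓ
ℂ-+-rawMonoid = record { Carrier = ℂ ; _≈_ = _≈ℂ_ ; _∙_ = _+ℂ_ ; ε = 0ℂ }

open RawMonoidDefinitions ℂ-+-rawMonoid public using () renaming (sum to ∑ℂ)

Vecℂ : ℕ → Set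
Vecℂ N = Fin N → ℂ

Matℂ : ℕ → Set
Matℂ N = Fin N → Fin N → ℂ

infix  4 _≈ᵥ_ _≈ₘ_
infixl 6 _-ₘ_
infixl 7 _*ₘ_
infixr 7 _·_ _•_

_≈ᵥ_ : ∀ {N} → Vecℂ N → Vecℂ N → Set
x ≈ᵥ y = ∀ i → x i ≈ℂ y i

_≈ₘ_ : ∀ {N} → Matℂ N → Matℂ N → Set
A ≈ₘ B = ∀ i j → A i j ≈ℂ B i j

_•_ : ∀ {N} → ℂ → Vecℂ N → Vecℂ N
(c • x) i = c *ℂ x i

∑ᵥ : ∀ {K N} → (Fin K → Vecℂ N) → Vecℂ N
∑ᵥ v j = ∑ℂ (λ i → v i j)

⟨_,_⟩ : ∀ {N} → Vecℂ N → Vecℂ N → ℂ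
⟨ a , b ⟩ = ∑ℂ (λ i → conj (b i) *ℂ a i)

∥_∥ : ∀ {N} → Vecℂ N → ℝ
∥ x ∥ = sqrtℝ (∑ℝ (λ i → ∣ x i ∣²))

_·_ : ∀ {N} → Matℂ N → Vecℂ N → Vecℂ N
(A · x) i = ∑ℂ (λ j → A i j *ℂ x j)

_*ₘ_ _-ₘ_ : ∀ {N} → Matℂ N → Matℂ N → Matℂ N
(A *ₘ B) i k = ∑ℂ (λ j → A i j *ℂ B j k)
(A -ₘ B) i j = A i j -ℂ B i j

_* : ∀ {N} → Matℂ N → Matℂ N
(A *) i j = conj (A j i)

diag : ∀ {N} → Vecℂ N → Matℂ N
diag d i j = if does (i ≟ᶠ j) then d i else 0ℂ

I : ∀ {N} → Matℂ N
I = diag (λ _ → 1ℂ)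

IsUnitary : ∀ {N} → Matℂ N → Set
IsUnitary U = (U * *ₘ U ≈ₘ I) × (U *ₘ U * ≈ₘ I)

-- s = sup { ∥ A x ∥ : ∥ x ∥ ≤ 1 }
IsSpectralNorm : ∀ {N} → Matℂ N → ℝ → Set
IsSpectralNorm {N} A s =
  IsSupremum (λ t → ∃[ x ] (∥ x ∥ ≤ℝ 1ℝ × t ≈ℝ ∥ A · x ∥)) s

IsOrthonormal : ∀ {K N} → (Fin K → Vecℂ N) → Set
IsOrthonormal ψ = ∀ i j → ⟨ ψ i , ψ j ⟩ ≈ℂ (if does (i ≟ᶠ j) then 1ℂ else 0ℂ)

-- The diagonal 0/1 matrix of a subset: D_S for a set of vertices, Σ_F for a
-- set of frequencies.
indicatorMatrix : ∀ {N} → Subset N → Matℂ N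
indicatorMatrix S = diag (λ i → if does (i ∈? S) then 1ℂ else 0ℂ)

bandLimiting : ∀ {N} → Matℂ N → Subset N → Matℂ N
bandLimiting U F = U *ₘ indicatorMatrix F *ₘ U *

{-# OPTIONS --safe #-}
module Submission where

-- Completeness of the ψᵢ comes from Hilbert–Schmidt norms. Both B = Σₖ bₖ bₖ* (bₖ the columns of U
-- with k ∈ F) and P = Σᵢ ψᵢ ψᵢ* have squared norm ∣F∣, and ⟨B,P⟩ = Σᵢ ⟨Bψᵢ,ψᵢ⟩ = ∣F∣, so ‖B − P‖² = 0 and
-- x = Bx = Σᵢ ⟨x,ψᵢ⟩ ψᵢ for band-limited x. Self-adjointness of B and D turns
-- BDψᵢ = σᵢ²ψᵢ into ⟨Dx,ψᵢ⟩ = σᵢ²⟨x,ψᵢ⟩. Finally B D̄ ψᵢ = (1 − σᵢ²)ψᵢ gives ∣1 − σᵢ²∣ ≤ ‖B D̄‖ < 1,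
-- which keeps σᵢ² away from 0.

open import Algebra.Bundles using (CommutativeRing)
open import Algebra.Core using (Op₁)
import Algebra.Consequences.Setoid as SetoidConsequences
import Algebra.Properties.Group as GroupProperties
import Algebra.Properties.Semiring.Sum as SemiringSum
import Algebra.Solver.Ring.NaturalCoefficients.Default as NaturalCoefficients
open import Data.Bool.Base using (true; false; if_then_else_)
open import Data.Fin.Base using (Fin; zero; suc)
open import Data.Fin.Properties using (_≟_)
open import Data.Nat.Base as ℕ using (ℕ)
import Data.Nat.Properties as ℕₚ
open import Data.Product.Base using (_×_; _,_; ∃-syntax; Σ-syntax)
import Data.Rational.Base as ℚ
open import Data.Rational.Solver using (module +-*-Solver)
open import Data.Sum.Base using (inj₁; inj₂)
open import Data.Vec.Base using ([]; _∷_)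
open import Level using (0ℓ; _⊔_)
open import Relation.Binary.PropositionalEquality.Core as ≡ using (_≡_; _≢_)
open import Relation.Binary.Bundles using (Setoid)
import Relation.Binary.Reasoning.Setoid as SetoidReasoning
open import Relation.Binary.Structures using (IsEquivalence)
open import Relation.Nullary.Decidable.Core using (does; yes; no)
open import Relation.Nullary.Negation.Core using (contradiction)

-- Orthogonal families and rank-one sums over a star ring

-- The usual route, that K orthonormal vectors in a K-dimensional range form a basis, needs a rank
-- or dimension argument, which is awkward when equality of complex numbers is not decidable. With
-- Hilbert-Schmidt norms all the counting sits in scalar identities, and passing from ‖B - P‖² = 0
-- to B = P asks only that a sum of squares dominate each of its terms. This definiteness fails in
-- general star rings, so the algebra takes it as a hypothesis and the analysis supplies it for ℂ.
--
-- Division is the second obstacle: a reciprocal requires an explicit positive rational below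
-- ∣σᵢ²∣², not merely σᵢ² different from 0. The strict inequality ‖B D̄‖ < 1 carries such a rational
-- gap, and the estimates transport it through the rounded square roots to σᵢ². The σᵢ² themselves
-- are given only as complex numbers; that they are fixed by conjugation is derived.

module _ {c ℓ} (R : CommutativeRing c ℓ) where
  open CommutativeRing R hiding (zero)

  record IsStarRing (_† : Op₁ Carrier) : Set (c ⊔ ℓ) where
    field
      †-cong       : ∀ {x y} → x ≈ y → x † ≈ y †
      †-homo-+     : ∀ x y → (x + y) † ≈ x † + y †
      †-homo-*     : ∀ x y → (x * y) † ≈ x † * y †
      †-homo-0     : 0# † ≈ 0#
      †-homo-1     : 1# † ≈ 1#
      †-involutive : ∀ x → x † † ≈ x

  record IsMatrixCalculus (_† : Op₁ Carrier)
      (∑ : ∀ {n} → (Fin n → Carrier) → Carrier)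
      (_·_ : ∀ {n} → (Fin n → Fin n → Carrier) → (Fin n → Carrier) → Fin n → Carrier)
      (⟪_,_⟫ : ∀ {n} → (Fin n → Carrier) → (Fin n → Carrier) → Carrier) : Set (c ⊔ ℓ) where
    field
      ∑-empty : ∀ t → ∑ {0} t ≈ 0#
      ∑-suc   : ∀ {n} t → ∑ {ℕ.suc n} t ≈ t zero + ∑ λ i → t (suc i)
      ·-def   : ∀ {n} A (x : Fin n → Carrier) i → (A · x) i ≈ ∑ λ j → A i j * x j
      ⟪⟫-def  : ∀ {n} (x y : Fin n → Carrier) → ⟪ x , y ⟫ ≈ ∑ λ i → y i † * x i

-- ∑, _·_ and ⟪_,_⟫ are parameters with defining equations, so that instances mention the given
-- operations literally: to compare two unfolded complex numbers the type checker would have to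
-- compare their proofs of Cauchyness.
module StarLinearAlgebra {c ℓ} (R : CommutativeRing c ℓ) (_† : Op₁ (CommutativeRing.Carrier R))
    (isStarRing : IsStarRing R _†)
    (∑ : ∀ {n} → (Fin n → CommutativeRing.Carrier R) → CommutativeRing.Carrier R)
    (_·_ : ∀ {n} → (Fin n → Fin n → CommutativeRing.Carrier R) → (Fin n → CommutativeRing.Carrier R) →
           Fin n → CommutativeRing.Carrier R)
    (⟪_,_⟫ : ∀ {n} → (Fin n → CommutativeRing.Carrier R) → (Fin n → CommutativeRing.Carrier R) →
             CommutativeRing.Carrier R)
    (isMatrixCalculus : IsMatrixCalculus R _† ∑ _·_ ⟪_,_⟫) where

  open import Data.Fin.Subset using (Subset; inside; outside; ∣_∣)
  open import Data.Fin.Subset.Properties using (_∈?_)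
  open CommutativeRing R hiding (zero)
  open IsStarRing isStarRing
  open IsMatrixCalculus isMatrixCalculus
  open SemiringSum semiring using (sum; sum-cong-≋; sum-replicate-zero; *-distribˡ-sum; *-distribʳ-sum)
    renaming (∑-distrib-+ to sum-distrib-+; ∑-comm to sum-comm)
  open GroupProperties +-group using (∙-cancelʳ)
  open SetoidReasoning setoid
  open NaturalCoefficients commutativeSemiring using (solve; _:+_; _:*_; _:=_)

  infixr 7 _•_

  Vect : ℕ → Set c
  Vect n = Fin n → Carrier

  Mat : ℕ → Set c
  Mat n = Fin n → Fin n → Carrier

  _•_ : ∀ {n} → Carrier → Vect n → Vect n
  (a • x) i = a * x i

  -- A relation and not an operation, so that a concrete product can remain a folded term whose
  -- entries are known only up to `≈`.
  IsProduct : ∀ {n} → Mat n → Mat n → Mat n → Set ℓ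
  IsProduct E A C = ∀ i k → E i k ≈ ∑ λ j → A i j * C j k

  -- Spelled exactly as `diag` and as the right-hand side of `IsOrthonormal`, so that `I`,
  -- `indicatorMatrix` and the orthonormality hypothesis are instances by unfolding.
  diagonal : ∀ {n} → Vect n → Mat n
  diagonal d i j = if does (i ≟ j) then d i else 0#

  -- The operator Σₖ vₖ vₖ*; over ℂ and for an orthonormal family, the orthogonal projection onto
  -- its span.
  outer : ∀ {m n} → (Fin m → Vect n) → Mat n
  outer v i j = ∑ λ k → v k i * v k j †

  -- The Hilbert-Schmidt product, that is, the trace of A C*.
  frobenius : ∀ {n} → Mat n → Mat n → Carrier
  frobenius A C = ∑ λ i → ∑ λ j → A i j * C i j †

  Hermitian : ∀ {n} → Mat n → Set ℓ
  Hermitian A = ∀ i j → A i j † ≈ A j i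

  -- The squared norms d may vanish. This admits the family of all n masked columns of U, zero
  -- outside F, and so avoids enumerating F.
  Orthogonal : ∀ {m n} → (Fin m → Vect n) → Vect m → Set ℓ
  Orthogonal v d = ∀ k l → ⟪ v k , v l ⟫ ≈ diagonal d k l

  [x-y]+y : ∀ x y → (x + (- y)) + y ≈ x
  [x-y]+y x y = trans (+-assoc x (- y) y) (trans (+-congˡ (-‿inverseˡ y)) (+-identityʳ x))

  -- Finite sums

  ∑≈sum : ∀ {n} (t : Vect n) → ∑ t ≈ sum t
  ∑≈sum {ℕ.zero}  t = ∑-empty t
  ∑≈sum {ℕ.suc n} t = trans (∑-suc t) (+-congˡ (∑≈sum λ i → t (suc i)))

  ∑-cong : ∀ {n} {s t : Vect n} → (∀ i → s i ≈ t i) → ∑ s ≈ ∑ t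
  ∑-cong {s = s} {t} e = trans (∑≈sum s) (trans (sum-cong-≋ e) (sym (∑≈sum t)))

  ∑₂≈sum : ∀ {m n} (t : Fin m → Vect n) → ∑ (λ i → ∑ (t i)) ≈ sum (λ i → sum (t i))
  ∑₂≈sum t = trans (∑-cong λ i → ∑≈sum (t i)) (∑≈sum λ i → sum (t i))

  ∑-comm : ∀ {m n} (t : Fin m → Vect n) → ∑ (λ i → ∑ (t i)) ≈ ∑ (λ j → ∑ λ i → t i j)
  ∑-comm t = trans (∑₂≈sum t) (trans (sum-comm t) (sym (∑₂≈sum λ j i → t i j)))

  ∑-distrib-+ : ∀ {n} (s t : Vect n) → ∑ (λ i → s i + t i) ≈ ∑ s + ∑ t
  ∑-distrib-+ s t = trans (∑≈sum λ i → s i + t i)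
    (trans (sum-distrib-+ s t) (sym (+-cong (∑≈sum s) (∑≈sum t))))

  *-distribˡ-∑ : ∀ {n} a (t : Vect n) → a * ∑ t ≈ ∑ λ i → a * t i
  *-distribˡ-∑ a t = trans (*-congˡ (∑≈sum t))
    (trans (*-distribˡ-sum a t) (sym (∑≈sum λ i → a * t i)))

  *-distribʳ-∑ : ∀ {n} a (t : Vect n) → ∑ t * a ≈ ∑ λ i → t i * a
  *-distribʳ-∑ a t = trans (*-congʳ (∑≈sum t))
    (trans (*-distribʳ-sum a t) (sym (∑≈sum λ i → t i * a)))

  ∑₂-cong : ∀ {m n} {s t : Fin m → Vect n} → (∀ i j → s i j ≈ t i j) →
    ∑ (λ i → ∑ (s i)) ≈ ∑ (λ i → ∑ (t i))
  ∑₂-cong e = ∑-cong λ i → ∑-cong (e i)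

  ∑₂-distrib-+ : ∀ {m n} (s t : Fin m → Vect n) →
    ∑ (λ i → ∑ λ j → s i j + t i j) ≈ ∑ (λ i → ∑ (s i)) + ∑ (λ i → ∑ (t i))
  ∑₂-distrib-+ s t =
    trans (∑-cong λ i → ∑-distrib-+ (s i) (t i)) (∑-distrib-+ (λ i → ∑ (s i)) (λ i → ∑ (t i)))

  ∑-homo-† : ∀ {n} (t : Vect n) → ∑ t † ≈ ∑ (λ i → t i †)
  ∑-homo-† {ℕ.zero}  t = trans (†-cong (∑-empty t)) (trans †-homo-0 (sym (∑-empty _)))
  ∑-homo-† {ℕ.suc n} t = trans (†-cong (∑-suc t)) (trans (†-homo-+ (t zero) _)
    (trans (+-congˡ (∑-homo-† (λ i → t (suc i)))) (sym (∑-suc _))))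

  ∑-zero : ∀ {n} {t : Vect n} → (∀ i → t i ≈ 0#) → ∑ t ≈ 0#
  ∑-zero {n} e = trans (∑≈sum _) (trans (sum-cong-≋ e) (sum-replicate-zero n))

  ∑-single : ∀ {n} (k : Fin n) (t : Vect n) → (∀ i → i ≢ k → t i ≈ 0#) → ∑ t ≈ t k
  ∑-single zero    t e =
    trans (∑-suc t) (trans (+-congˡ (∑-zero λ i → e (suc i) λ ())) (+-identityʳ (t zero)))
  ∑-single (suc k) t e =
    trans (∑-suc t) (trans (+-cong (e zero λ ()) (∑-single k (λ i → t (suc i)) λ i i≢k → e (suc i) λ { ≡.refl → i≢k ≡.refl }))
          (+-identityˡ (t (suc k))))

  -- Diagonal matrices and the action of matrices on vectors

  diagonal-same : ∀ {n} (d : Vect n) i → diagonal d i i ≈ d i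
  diagonal-same d i with i ≟ i
  ... | yes _  = refl
  ... | no i≢i = contradiction ≡.refl i≢i

  diagonal-distinct : ∀ {n} (d : Vect n) {i j} → i ≢ j → diagonal d i j ≈ 0#
  diagonal-distinct d {i} {j} i≢j with i ≟ j
  ... | yes i≡j = contradiction i≡j i≢j
  ... | no _    = refl

  diagonal-hermitian : ∀ {n} (d : Vect n) → (∀ i → d i † ≈ d i) → Hermitian (diagonal d)
  diagonal-hermitian d d† i j with i ≟ j
  ... | yes ≡.refl = trans (d† i) (sym (diagonal-same d i))
  ... | no i≢j     = trans †-homo-0 (sym (diagonal-distinct d λ e → i≢j (≡.sym e)))

  diagonal-· : ∀ {n} (d x : Vect n) i → (diagonal d · x) i ≈ d i * x i
  diagonal-· d x i = trans (·-def _ x i) (trans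
    (∑-single i _ λ j j≢i → trans (*-congʳ (diagonal-distinct d λ e → j≢i (≡.sym e))) (zeroˡ (x j)))
    (*-congʳ (diagonal-same d i)))

  product-diagonal : ∀ {n} {E A C : Mat n} {d : Vect n} → IsProduct E A C →
    (∀ i j → C i j ≈ diagonal d i j) → ∀ i k → E i k ≈ A i k * d k
  product-diagonal {A = A} {d = d} E≈ C≈ i k = trans (E≈ i k) (trans
    (∑-single k _ λ j j≢k → trans (*-congˡ (trans (C≈ j k) (diagonal-distinct d j≢k))) (zeroʳ (A i j)))
    (*-congˡ (trans (C≈ k k) (diagonal-same d k))))

  ·-cong : ∀ {n} {A C : Mat n} {x y : Vect n} → (∀ i j → A i j ≈ C i j) → (∀ i → x i ≈ y i) →
    ∀ i → (A · x) i ≈ (C · y) i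
  ·-cong {A = A} {C} {x} {y} e f i =
    trans (·-def A x i) (trans (∑-cong λ j → *-cong (e i j) (f j)) (sym (·-def C y i)))

  ·-congˡ : ∀ {n} (A : Mat n) {x y : Vect n} → (∀ i → x i ≈ y i) → ∀ i → (A · x) i ≈ (A · y) i
  ·-congˡ A = ·-cong λ _ _ → refl

  ·-distribˡ-+ : ∀ {n} (A : Mat n) (x y : Vect n) i → (A · λ j → x j + y j) i ≈ (A · x) i + (A · y) i
  ·-distribˡ-+ A x y i = begin
    (A · λ j → x j + y j) i                       ≈⟨ ·-def A _ i ⟩
    (∑ λ j → A i j * (x j + y j))                 ≈⟨ ∑-cong (λ j → distribˡ (A i j) (x j) (y j)) ⟩
    (∑ λ j → A i j * x j + A i j * y j)           ≈⟨ ∑-distrib-+ _ _ ⟩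
    (∑ λ j → A i j * x j) + (∑ λ j → A i j * y j) ≈⟨ +-cong (·-def A x i) (·-def A y i) ⟨
    (A · x) i + (A · y) i                         ∎

  ·-distribʳ-+ : ∀ {n} (A C : Mat n) (x : Vect n) i →
    ((λ i j → A i j + C i j) · x) i ≈ (A · x) i + (C · x) i
  ·-distribʳ-+ A C x i = begin
    ((λ i j → A i j + C i j) · x) i               ≈⟨ ·-def _ x i ⟩
    (∑ λ j → (A i j + C i j) * x j)               ≈⟨ ∑-cong (λ j → distribʳ (x j) (A i j) (C i j)) ⟩
    (∑ λ j → A i j * x j + C i j * x j)           ≈⟨ ∑-distrib-+ _ _ ⟩
    (∑ λ j → A i j * x j) + (∑ λ j → C i j * x j) ≈⟨ +-cong (·-def A x i) (·-def C x i) ⟨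
    (A · x) i + (C · x) i                         ∎

  product-· : ∀ {n} {E A C : Mat n} → IsProduct E A C → ∀ (x : Vect n) i → (E · x) i ≈ (A · (C · x)) i
  product-· {E = E} {A} {C} E≈ x i = begin
    (E · x) i
      ≈⟨ trans (·-def E x i) (∑-cong λ k → *-congʳ (E≈ i k)) ⟩
    (∑ λ k → (∑ λ j → A i j * C j k) * x k)
      ≈⟨ ∑-cong (λ k → *-distribʳ-∑ (x k) _) ⟩
    (∑ λ k → ∑ λ j → (A i j * C j k) * x k)
      ≈⟨ ∑-comm (λ k j → (A i j * C j k) * x k) ⟩
    (∑ λ j → ∑ λ k → (A i j * C j k) * x k)
      ≈⟨ ∑₂-cong (λ j k → *-assoc (A i j) (C j k) (x k)) ⟩
    (∑ λ j → ∑ λ k → A i j * (C j k * x k))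
      ≈⟨ ∑-cong (λ j → *-distribˡ-∑ (A i j) _) ⟨
    (∑ λ j → A i j * (∑ λ k → C j k * x k))
      ≈⟨ ∑-cong (λ j → *-congˡ (·-def C x j)) ⟨
    (∑ λ j → A i j * (C · x) j)
      ≈⟨ ·-def A _ i ⟨
    (A · (C · x)) i ∎

  -- Inner products and self-adjointness

  ⟪⟫-cong : ∀ {n} {w x y z : Vect n} → (∀ i → w i ≈ x i) → (∀ i → y i ≈ z i) →
    ⟪ w , y ⟫ ≈ ⟪ x , z ⟫
  ⟪⟫-cong {w = w} {x} {y} {z} e f = trans (⟪⟫-def w y)
    (trans (∑-cong λ i → *-cong (†-cong (f i)) (e i)) (sym (⟪⟫-def x z)))

  ⟪⟫-conj : ∀ {n} (x y : Vect n) → ⟪ x , y ⟫ † ≈ ⟪ y , x ⟫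
  ⟪⟫-conj x y = trans (trans (†-cong (⟪⟫-def x y)) (∑-homo-† _)) (trans (∑-cong λ i → begin
    (y i † * x i) †     ≈⟨ †-homo-* (y i †) (x i) ⟩
    (y i †) † * x i †   ≈⟨ *-congʳ (†-involutive (y i)) ⟩
    y i * x i †         ≈⟨ *-comm (y i) (x i †) ⟩
    x i † * y i         ∎) (sym (⟪⟫-def y x)))

  ⟪•,⟫ : ∀ {n} a (x y : Vect n) → ⟪ a • x , y ⟫ ≈ a * ⟪ x , y ⟫
  ⟪•,⟫ a x y = begin
    ⟪ a • x , y ⟫               ≈⟨ ⟪⟫-def _ y ⟩
    (∑ λ i → y i † * (a * x i)) ≈⟨ ∑-cong (λ i → solve 3 (λ a u v → v :* (a :* u) := a :* (v :* u)) refl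
                                     a (x i) (y i †)) ⟩
    (∑ λ i → a * (y i † * x i)) ≈⟨ *-distribˡ-∑ a _ ⟨
    a * (∑ λ i → y i † * x i)   ≈⟨ *-congˡ (⟪⟫-def x y) ⟨
    a * ⟪ x , y ⟫               ∎

  ⟪,•⟫ : ∀ {n} a (x y : Vect n) → ⟪ x , a • y ⟫ ≈ a † * ⟪ x , y ⟫
  ⟪,•⟫ a x y = begin
    ⟪ x , a • y ⟫               ≈⟨ ⟪⟫-conj (a • y) x ⟨
    ⟪ a • y , x ⟫ †             ≈⟨ †-cong (⟪•,⟫ a y x) ⟩
    (a * ⟪ y , x ⟫) †           ≈⟨ †-homo-* a _ ⟩
    a † * ⟪ y , x ⟫ †           ≈⟨ *-congˡ (⟪⟫-conj y x) ⟩
    a † * ⟪ x , y ⟫             ∎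

  hermitian-selfAdjoint : ∀ {n} {A : Mat n} → Hermitian A → ∀ x y → ⟪ A · x , y ⟫ ≈ ⟪ x , A · y ⟫
  hermitian-selfAdjoint {n} {A} A† x y = begin
    ⟪ A · x , y ⟫
      ≈⟨ trans (⟪⟫-def _ y) (∑-cong λ i → *-congˡ (·-def A x i)) ⟩
    (∑ λ i → y i † * (∑ λ j → A i j * x j))
      ≈⟨ ∑-cong (λ i → *-distribˡ-∑ (y i †) _) ⟩
    (∑ λ i → ∑ λ j → y i † * (A i j * x j))
      ≈⟨ ∑-comm (λ i j → y i † * (A i j * x j)) ⟩
    (∑ λ j → ∑ λ i → y i † * (A i j * x j))
      ≈⟨ ∑₂-cong (λ j i → begin
           y i † * (A i j * x j)
             ≈⟨ solve 3 (λ y a x → y :* (a :* x) := (a :* y) :* x) refl (y i †) (A i j) (x j) ⟩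
           (A i j * y i †) * x j
             ≈⟨ *-congʳ (*-congʳ (A† j i)) ⟨
           (A j i † * y i †) * x j
             ≈⟨ *-congʳ (†-homo-* (A j i) (y i)) ⟨
           (A j i * y i) † * x j ∎) ⟩
    (∑ λ j → ∑ λ i → (A j i * y i) † * x j)
      ≈⟨ ∑-cong (λ j → *-distribʳ-∑ (x j) _) ⟨
    (∑ λ j → (∑ λ i → (A j i * y i) †) * x j)
      ≈⟨ ∑-cong (λ j → *-congʳ (∑-homo-† _)) ⟨
    (∑ λ j → (∑ λ i → A j i * y i) † * x j)
      ≈⟨ trans (⟪⟫-def x _) (∑-cong λ j → *-congʳ (†-cong (·-def A y j))) ⟨
    ⟪ x , A · y ⟫ ∎

  -- Rank-one sums and the Hilbert-Schmidt product

  outer-hermitian : ∀ {m n} (v : Fin m → Vect n) → Hermitian (outer v)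
  outer-hermitian {m} {n} v i j = trans (∑-homo-† _) (∑-cong λ k → begin
    (v k i * v k j †) †     ≈⟨ †-homo-* (v k i) (v k j †) ⟩
    v k i † * (v k j †) †   ≈⟨ *-congˡ (†-involutive (v k j)) ⟩
    v k i † * v k j         ≈⟨ *-comm (v k i †) (v k j) ⟩
    v k j * v k i †         ∎)

  outer-· : ∀ {m n} (v : Fin m → Vect n) x i → (outer v · x) i ≈ ∑ λ k → ⟪ x , v k ⟫ * v k i
  outer-· {m} {n} v x i = begin
    (outer v · x) i
      ≈⟨ ·-def _ x i ⟩
    (∑ λ j → (∑ λ k → v k i * v k j †) * x j)
      ≈⟨ ∑-cong (λ j → *-distribʳ-∑ (x j) _) ⟩
    (∑ λ j → ∑ λ k → (v k i * v k j †) * x j)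
      ≈⟨ ∑-comm (λ j k → (v k i * v k j †) * x j) ⟩
    (∑ λ k → ∑ λ j → (v k i * v k j †) * x j)
      ≈⟨ ∑₂-cong (λ k j → solve 3 (λ u w x → (u :* w) :* x := (w :* x) :* u) refl
           (v k i) (v k j †) (x j)) ⟩
    (∑ λ k → ∑ λ j → (v k j † * x j) * v k i)
      ≈⟨ ∑-cong (λ k → trans (*-congʳ (⟪⟫-def x (v k))) (*-distribʳ-∑ (v k i) _)) ⟨
    (∑ λ k → ⟪ x , v k ⟫ * v k i) ∎

  outer-·-orthogonal : ∀ {m n} {v : Fin m → Vect n} {d} → Orthogonal v d →
    ∀ k i → (outer v · v k) i ≈ d k * v k i
  outer-·-orthogonal {v = v} {d} v⊥ k i = begin
    (outer v · v k) i                 ≈⟨ outer-· v (v k) i ⟩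
    (∑ λ l → ⟪ v k , v l ⟫ * v l i) ≈⟨ ∑-cong (λ l → *-congʳ (v⊥ k l)) ⟩
    (∑ λ l → diagonal d k l * v l i)  ≈⟨ ·-def (diagonal d) _ k ⟨
    (diagonal d · (λ l → v l i)) k    ≈⟨ diagonal-· d (λ l → v l i) k ⟩
    d k * v k i                       ∎

  frobenius-conj : ∀ {n} (A C : Mat n) → frobenius A C † ≈ frobenius C A
  frobenius-conj {n} A C = trans (∑-homo-† _) (trans (∑-cong λ i → ∑-homo-† _)
    (∑₂-cong λ i j → begin
      (A i j * C i j †) †     ≈⟨ †-homo-* (A i j) (C i j †) ⟩
      A i j † * (C i j †) †   ≈⟨ *-congˡ (†-involutive (C i j)) ⟩
      A i j † * C i j         ≈⟨ *-comm (A i j †) (C i j) ⟩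
      C i j * A i j †         ∎))

  -- Cyclicity of the trace, tr(A v v*) = v* A v, summed over the family. It reduces Hilbert-Schmidt
  -- products with a rank-one sum to the action of A on the vectors.
  frobenius-outer : ∀ {m n} (A : Mat n) (v : Fin m → Vect n) →
    frobenius A (outer v) ≈ ∑ λ k → ⟪ A · v k , v k ⟫
  frobenius-outer {m} {n} A v = begin
    (∑ λ i → ∑ λ j → A i j * (outer v i j) †)
      ≈⟨ ∑₂-cong (λ i j → *-congˡ (outer-hermitian v i j)) ⟩
    (∑ λ i → ∑ λ j → A i j * outer v j i)
      ≈⟨ ∑₂-cong (λ i j → *-distribˡ-∑ (A i j) _) ⟩
    (∑ λ i → ∑ λ j → ∑ λ k → A i j * (v k j * v k i †))
      ≈⟨ ∑-cong (λ i → ∑-comm (λ j k → A i j * (v k j * v k i †))) ⟩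
    (∑ λ i → ∑ λ k → ∑ λ j → A i j * (v k j * v k i †))
      ≈⟨ ∑-comm (λ i k → ∑ λ j → A i j * (v k j * v k i †)) ⟩
    (∑ λ k → ∑ λ i → ∑ λ j → A i j * (v k j * v k i †))
      ≈⟨ ∑₂-cong (λ k i → ∑-cong λ j →
           solve 3 (λ a u w → a :* (u :* w) := w :* (a :* u)) refl (A i j) (v k j) (v k i †)) ⟩
    (∑ λ k → ∑ λ i → ∑ λ j → v k i † * (A i j * v k j))
      ≈⟨ ∑₂-cong (λ k i → *-distribˡ-∑ (v k i †) _) ⟨
    (∑ λ k → ∑ λ i → v k i † * (∑ λ j → A i j * v k j))
      ≈⟨ ∑-cong (λ k → trans (⟪⟫-def _ (v k)) (∑-cong λ i → *-congˡ (·-def A (v k) i))) ⟨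
    (∑ λ k → ⟪ A · v k , v k ⟫) ∎

  -- ‖Q‖² = ‖A‖² − ⟨A,C⟩ − ⟨C,A⟩ + ‖C‖² for A = Q + C, stated without subtraction.
  frobenius-polarisation : ∀ {n} (A C Q : Mat n) → (∀ i j → A i j ≈ Q i j + C i j) →
    frobenius Q Q + (frobenius A C + frobenius C A) ≈ frobenius A A + frobenius C C
  frobenius-polarisation {n} A C Q e = begin
    frobenius Q Q + (frobenius A C + frobenius C A)
      ≈⟨ +-congˡ (∑₂-distrib-+ _ _) ⟨
    frobenius Q Q + (∑ λ i → ∑ λ j → A i j * C i j † + C i j * A i j †)
      ≈⟨ ∑₂-distrib-+ _ _ ⟨
    (∑ λ i → ∑ λ j → Q i j * Q i j † + (A i j * C i j † + C i j * A i j †))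
      ≈⟨ ∑₂-cong (λ i j → entry (A i j) (C i j) (Q i j) (e i j)) ⟩
    (∑ λ i → ∑ λ j → A i j * A i j † + C i j * C i j †)
      ≈⟨ ∑₂-distrib-+ _ _ ⟩
    frobenius A A + frobenius C C ∎
    where
    entry : ∀ a c q → a ≈ q + c → q * q † + (a * c † + c * a †) ≈ a * a † + c * c †
    entry a c q a≈q+c = begin
      q * q † + (a * c † + c * a †)
        ≈⟨ +-congˡ (+-cong (*-congʳ a≈q+c) (*-congˡ a†)) ⟩
      q * q † + ((q + c) * c † + c * (q † + c †))
        -- Once a† is expanded, q† and c† act as independent variables, and an identity of
        -- commutative semirings remains.
        ≈⟨ solve 4 (λ q c q′ c′ → q :* q′ :+ ((q :+ c) :* c′ :+ c :* (q′ :+ c′))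
             := (q :+ c) :* (q′ :+ c′) :+ c :* c′) refl q c (q †) (c †) ⟩
      (q + c) * (q † + c †) + c * c †
        ≈⟨ +-congʳ (*-cong a≈q+c a†) ⟨
      a * a † + c * c † ∎
      where
      a† : a † ≈ q † + c †
      a† = trans (†-cong a≈q+c) (†-homo-+ q c)

  -- Every term ⟨A vₖ, vₖ⟩ is ⟨vₖ, vₖ⟩ = 1. This serves twice: A itself gives ⟨A,P⟩, and P =
  -- `outer v` in the place of A gives ‖P‖².
  frobenius-outer-orthonormal : ∀ {m n} {A : Mat n} {v : Fin m → Vect n} →
    Orthogonal v (λ _ → 1#) → (∀ k i → (A · v k) i ≈ v k i) →
    frobenius A (outer v) ≈ ∑ {m} (λ _ → 1#)
  frobenius-outer-orthonormal {m} {A = A} {v} v⊥ Av = trans (frobenius-outer A v) (∑-cong λ k →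
    trans (⟪⟫-cong (Av k) (λ _ → refl)) (trans (v⊥ k k) (diagonal-same (λ _ → 1#) k)))

  -- With P = outer v: ‖A‖² = ‖P‖², and ⟨A,P⟩ = ‖P‖² because A fixes every v k; so ‖A − P‖² = 0.
  equal-trace⇒equal : ∀ {m n} {A : Mat n} {v : Fin m → Vect n} →
    (∀ (Q : Mat n) → frobenius Q Q ≈ 0# → ∀ i j → Q i j ≈ 0#) →
    Orthogonal v (λ _ → 1#) → (∀ k i → (A · v k) i ≈ v k i) →
    frobenius A A ≈ ∑ {m} (λ _ → 1#) →
    ∀ i j → A i j ≈ outer v i j
  equal-trace⇒equal {m} {A = A} {v} definite v⊥ Av ∥A∥² i j =
    trans (Q+P i j) (trans (+-congʳ (definite Q ∥Q∥² i j)) (+-identityˡ (P i j)))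
    where
    P : Mat _
    P = outer v
    Q : Mat _
    Q i j = A i j + (- P i j)
    Q+P : ∀ i j → A i j ≈ Q i j + P i j
    Q+P i j = sym ([x-y]+y (A i j) (P i j))
    κ : Carrier
    κ = ∑ {m} (λ _ → 1#)
    ⟨A,P⟩ : frobenius A P ≈ κ
    ⟨A,P⟩ = frobenius-outer-orthonormal v⊥ Av
    ⟨P,A⟩ : frobenius P A ≈ κ
    -- ⟨P,A⟩ is the conjugate of ⟨A,P⟩, and κ, being a sum of ones, is fixed by †.
    ⟨P,A⟩ = trans (sym (frobenius-conj A P)) (trans (†-cong ⟨A,P⟩)
      (trans (∑-homo-† (λ _ → 1#)) (∑-cong λ _ → †-homo-1)))
    ∥Q∥² : frobenius Q Q ≈ 0#
    ∥Q∥² = ∙-cancelʳ (κ + κ) (frobenius Q Q) 0# (begin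
      frobenius Q Q + (κ + κ)
        ≈⟨ +-congˡ (+-cong ⟨A,P⟩ ⟨P,A⟩) ⟨
      frobenius Q Q + (frobenius A P + frobenius P A)
        ≈⟨ frobenius-polarisation A P Q Q+P ⟩
      frobenius A A + frobenius P P
        ≈⟨ +-cong ∥A∥² (frobenius-outer-orthonormal {v = v} v⊥
             (λ k i → trans (outer-·-orthogonal {v = v} v⊥ k i) (*-identityˡ (v k i)))) ⟩
      κ + κ
        ≈⟨ +-identityˡ (κ + κ) ⟨
      0# + (κ + κ) ∎)

  frobenius-cong : ∀ {n} {A C E F : Mat n} → (∀ i j → A i j ≈ C i j) → (∀ i j → E i j ≈ F i j) →
    frobenius A E ≈ frobenius C F
  frobenius-cong e f = ∑₂-cong λ i j → *-cong (e i j) (†-cong (f i j))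

  ≈outer⇒hermitian : ∀ {m n} {A : Mat n} (v : Fin m → Vect n) →
    (∀ i j → A i j ≈ outer v i j) → Hermitian A
  ≈outer⇒hermitian v A≈ i j =
    trans (†-cong (A≈ i j)) (trans (outer-hermitian v i j) (sym (A≈ j i)))

  -- The k-th vector contributes dₖ⟨vₖ, vₖ⟩ = dₖ², and idempotence turns this into dₖ.
  ≈outer⇒frobenius : ∀ {m n} {A : Mat n} (v : Fin m → Vect n) {d} → (∀ k → d k * d k ≈ d k) →
    Orthogonal v d → (∀ i j → A i j ≈ outer v i j) → frobenius A A ≈ ∑ d
  ≈outer⇒frobenius {m} v {d} d² v⊥ A≈ =
    trans (trans (frobenius-cong A≈ A≈) (frobenius-outer (outer v) v)) (∑-cong λ k → begin
      ⟪ outer v · v k , v k ⟫ ≈⟨ ⟪⟫-cong (outer-·-orthogonal {v = v} v⊥ k) (λ _ → refl) ⟩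
      ⟪ d k • v k , v k ⟫     ≈⟨ ⟪•,⟫ (d k) (v k) (v k) ⟩
      d k * ⟪ v k , v k ⟫     ≈⟨ *-congˡ (trans (v⊥ k k) (diagonal-same d k)) ⟩
      d k * d k               ≈⟨ d² k ⟩
      d k                     ∎)

  -- Indicators and cardinality

  indicator : ∀ {n} → Subset n → Vect n
  indicator F i = if does (i ∈? F) then 1# else 0#

  indicator-idempotent : ∀ {n} (F : Subset n) i → indicator F i * indicator F i ≈ indicator F i
  indicator-idempotent F i with does (i ∈? F)
  ... | true  = *-identityˡ 1#
  ... | false = zeroˡ 0#

  indicator-selfAdjoint : ∀ {n} (F : Subset n) i → indicator F i † ≈ indicator F i
  indicator-selfAdjoint F i with does (i ∈? F)
  ... | true  = †-homo-1
  ... | false = †-homo-0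

  -- The cardinality of F is kept as a sum of ones over `Fin ∣ F ∣`, the index set of the ψᵢ, so
  -- that the norm of B can be compared with that of P without a bijection between F and this index
  -- set.
  ∑-indicator : ∀ {n} (F : Subset n) → ∑ (indicator F) ≈ ∑ {∣ F ∣} (λ _ → 1#)
  ∑-indicator []            = trans (∑-empty _) (sym (∑-empty _))
  ∑-indicator (inside ∷ F)  = trans (∑-suc _) (trans (+-congˡ (∑-indicator F)) (sym (∑-suc _)))
  ∑-indicator (outside ∷ F) = trans (∑-suc _) (trans (+-identityˡ _) (∑-indicator F))

  ⟪⟫-scaled-unit : ∀ {n} {a} {r x : Vect n} → (∀ i → r i ≈ a * x i) → ⟪ x , x ⟫ ≈ 1# →
    ⟪ r , r ⟫ ≈ a * a †
  ⟪⟫-scaled-unit {a = a} {r} {x} r≈ax xx = begin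
    ⟪ r , r ⟫               ≈⟨ ⟪⟫-cong r≈ax r≈ax ⟩
    ⟪ a • x , a • x ⟫       ≈⟨ ⟪•,⟫ a x (a • x) ⟩
    a * ⟪ x , a • x ⟫       ≈⟨ *-congˡ (⟪,•⟫ a x x) ⟩
    a * (a † * ⟪ x , x ⟫)   ≈⟨ *-congˡ (trans (*-congˡ xx) (*-identityʳ (a †))) ⟩
    a * a †                 ∎

  module Band {n} {U U* Σ UΣ B : Mat n} {d : Vect n}
      (U*-adjoint : ∀ i j → U* i j ≈ U j i †) (Σ-diagonal : ∀ i j → Σ i j ≈ diagonal d i j)
      (UΣ-product : IsProduct UΣ U Σ) (B-product : IsProduct B UΣ U*)
      (d² : ∀ k → d k * d k ≈ d k) (d† : ∀ k → d k † ≈ d k) where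

    bandVector : Fin n → Vect n
    bandVector k = d k • λ i → U i k

    -- The mask d is idempotent and self-adjoint, so the single factor dₖ coming from Σ splits into
    -- one for each side of the k-th rank-one term.
    band≈outer : ∀ i j → B i j ≈ outer bandVector i j
    band≈outer i j = trans (B-product i j) (∑-cong λ k → begin
      UΣ i k * U* k j
        ≈⟨ *-cong (product-diagonal UΣ-product Σ-diagonal i k) (U*-adjoint k j) ⟩
      (U i k * d k) * U j k †
        ≈⟨ *-congʳ (*-congˡ (d² k)) ⟨
      (U i k * (d k * d k)) * U j k †
        ≈⟨ solve 3 (λ u d w → (u :* (d :* d)) :* w := (d :* u) :* (d :* w)) refl
             (U i k) (d k) (U j k †) ⟩
      (d k * U i k) * (d k * U j k †)
        ≈⟨ *-congˡ (*-congʳ (d† k)) ⟨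
      (d k * U i k) * (d k † * U j k †)
        ≈⟨ *-congˡ (†-homo-* (d k) (U j k)) ⟨
      (d k * U i k) * (d k * U j k) † ∎)

    bandVector-orthogonal : ∀ {E} → IsProduct E U* U → (∀ k l → E k l ≈ diagonal (λ _ → 1#) k l) →
      Orthogonal bandVector d
    bandVector-orthogonal {E} E-product E≈1 k l = begin
      ⟪ bandVector k , bandVector l ⟫
        ≈⟨ ⟪•,⟫ (d k) _ (bandVector l) ⟩
      d k * ⟪ (λ i → U i k) , bandVector l ⟫
        ≈⟨ *-congˡ (⟪,•⟫ (d l) _ (λ i → U i l)) ⟩
      d k * (d l † * ⟪ (λ i → U i k) , (λ i → U i l) ⟫)
        ≈⟨ *-congˡ (*-cong (d† l) (begin
             ⟪ (λ i → U i k) , (λ i → U i l) ⟫ ≈⟨ ⟪⟫-def _ _ ⟩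
             (∑ λ i → U i l † * U i k)         ≈⟨ ∑-cong (λ i → *-congʳ (U*-adjoint l i)) ⟨
             -- The second argument of the inner product is the conjugated one, hence the transposed
             -- indices: ⟨uₖ, uₗ⟩ is the entry (l, k) of U*U.
             (∑ λ i → U* l i * U i k)          ≈⟨ E-product l k ⟨
             E l k                             ≈⟨ E≈1 l k ⟩
             diagonal (λ _ → 1#) l k           ∎)) ⟩
      d k * (d l * diagonal (λ _ → 1#) l k)
        ≈⟨ case ⟩
      diagonal d k l ∎
      where
      case : d k * (d l * diagonal (λ _ → 1#) l k) ≈ diagonal d k l
      case with k ≟ l
      ... | yes ≡.refl = trans (*-congˡ (trans (*-congˡ (diagonal-same (λ _ → 1#) k))
                                               (*-identityʳ (d k)))) (d² k)
      ... | no k≢l     = trans (*-congˡ (trans (*-congˡ (diagonal-distinct (λ _ → 1#) λ e → k≢l (≡.sym e)))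
                                               (zeroʳ (d l)))) (zeroʳ (d k))

  -- σ is the paper's σ².
  module Sampling {n} {B D : Mat n} (B† : Hermitian B) (D† : Hermitian D)
      {σ : Carrier} {ψ : Vect n} (Bψ : ∀ i → (B · ψ) i ≈ ψ i)
      (BDψ : ∀ i → (B · (D · ψ)) i ≈ σ * ψ i) where

    sample-coefficient : ∀ {x} → (∀ i → (B · x) i ≈ x i) → ⟪ D · x , ψ ⟫ ≈ σ † * ⟪ x , ψ ⟫
    sample-coefficient {x} Bx = begin
      ⟪ D · x , ψ ⟫       ≈⟨ hermitian-selfAdjoint D† x ψ ⟩
      ⟪ x , D · ψ ⟫       ≈⟨ ⟪⟫-cong Bx (λ _ → refl) ⟨
      ⟪ B · x , D · ψ ⟫   ≈⟨ hermitian-selfAdjoint B† x (D · ψ) ⟩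
      ⟪ x , B · (D · ψ) ⟫ ≈⟨ ⟪⟫-cong (λ _ → refl) BDψ ⟩
      ⟪ x , σ • ψ ⟫       ≈⟨ ⟪,•⟫ σ x ψ ⟩
      σ † * ⟪ x , ψ ⟫     ∎

    -- Taking x = ψ in `sample-coefficient` identifies σ† with ⟨Dψ, ψ⟩, which is fixed by † because
    -- D is Hermitian.
    eigenvalue-selfAdjoint : ⟪ ψ , ψ ⟫ ≈ 1# → σ † ≈ σ
    eigenvalue-selfAdjoint ψψ = begin
      σ †               ≈⟨ ⟪Dψ,ψ⟫ ⟨
      ⟪ D · ψ , ψ ⟫     ≈⟨ hermitian-selfAdjoint D† ψ ψ ⟩
      ⟪ ψ , D · ψ ⟫     ≈⟨ ⟪⟫-conj (D · ψ) ψ ⟨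
      ⟪ D · ψ , ψ ⟫ †   ≈⟨ †-cong ⟪Dψ,ψ⟫ ⟩
      (σ †) †           ≈⟨ †-involutive σ ⟩
      σ                 ∎
      where
      ⟪Dψ,ψ⟫ : ⟪ D · ψ , ψ ⟫ ≈ σ †
      ⟪Dψ,ψ⟫ = trans (sample-coefficient Bψ) (trans (*-congˡ ψψ) (*-identityʳ (σ †)))

    -- The complements D̄ and τ are described by sums, so after adding σψ to both sides
    -- distributivity reduces the claim to Bψ = ψ.
    residual-· : ∀ {D̄ : Mat n} {τ} → (∀ i j → D̄ i j + D i j ≈ diagonal (λ _ → 1#) i j) →
      τ + σ ≈ 1# → ∀ i → (B · (D̄ · ψ)) i ≈ τ * ψ i
    residual-· {D̄} {τ} D̄+D τ+σ i = ∙-cancelʳ (σ * ψ i) _ _ (begin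
      (B · (D̄ · ψ)) i + σ * ψ i
        ≈⟨ +-congˡ (BDψ i) ⟨
      (B · (D̄ · ψ)) i + (B · (D · ψ)) i
        ≈⟨ ·-distribˡ-+ B _ _ i ⟨
      (B · λ j → (D̄ · ψ) j + (D · ψ) j) i
        ≈⟨ ·-congˡ B (λ j → begin
             (D̄ · ψ) j + (D · ψ) j
               ≈⟨ ·-distribʳ-+ D̄ D ψ j ⟨
             ((λ i j → D̄ i j + D i j) · ψ) j
               ≈⟨ ·-cong D̄+D (λ _ → refl) j ⟩
             (diagonal (λ _ → 1#) · ψ) j
               ≈⟨ diagonal-· (λ _ → 1#) ψ j ⟩
             1# * ψ j
               ≈⟨ *-identityˡ (ψ j) ⟩
             ψ j ∎) i ⟩
      (B · ψ) i
        ≈⟨ Bψ i ⟩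
      ψ i
        ≈⟨ *-identityˡ (ψ i) ⟨
      1# * ψ i
        ≈⟨ *-congʳ τ+σ ⟨
      (τ + σ) * ψ i
        ≈⟨ distribʳ (ψ i) τ σ ⟩
      τ * ψ i + σ * ψ i ∎)

    reconstruction-coefficient : ⟪ ψ , ψ ⟫ ≈ 1# → ∀ {ρ} → ρ * σ ≈ 1# →
      ∀ {x} → (∀ i → (B · x) i ≈ x i) → ρ * ⟪ D · x , ψ ⟫ ≈ ⟪ x , ψ ⟫
    reconstruction-coefficient ψψ {ρ} ρσ {x} Bx = begin
      ρ * ⟪ D · x , ψ ⟫         ≈⟨ *-congˡ (trans (sample-coefficient Bx)
                                     (*-congʳ (eigenvalue-selfAdjoint ψψ))) ⟩
      ρ * (σ * ⟪ x , ψ ⟫)       ≈⟨ *-assoc ρ σ _ ⟨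
      (ρ * σ) * ⟪ x , ψ ⟫       ≈⟨ trans (*-congʳ ρσ) (*-identityˡ _) ⟩
      ⟪ x , ψ ⟫                 ∎

  -- Here ρ plays the part of 1/σ². The coefficients are a variable `a` with an equation, so that an
  -- instance can name its own coefficients literally.
  reconstruction : ∀ {m n} {B D : Mat n} → Hermitian B → Hermitian D →
    (ψ : Fin m → Vect n) (σ ρ : Vect m) → Orthogonal ψ (λ _ → 1#) →
    (∀ k i → (B · ψ k) i ≈ ψ k i) →
    (∀ k i → (B · (D · ψ k)) i ≈ σ k * ψ k i) →
    (∀ k → ρ k * σ k ≈ 1#) → (∀ i j → B i j ≈ outer ψ i j) →
    ∀ x → (∀ i → (B · x) i ≈ x i) → ∀ (a : Vect m) → (∀ k → a k ≈ ρ k * ⟪ D · x , ψ k ⟫) →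
    ∀ i → x i ≈ ∑ λ k → a k * ψ k i
  reconstruction {m} {n} {B} {D} B† D† ψ σ ρ ψ⊥ Bψ BDψ ρσ B≈ x Bx a a≈ i = begin
    x i                                           ≈⟨ Bx i ⟨
    (B · x) i                                     ≈⟨ ·-cong B≈ (λ _ → refl) i ⟩
    (outer ψ · x) i                               ≈⟨ outer-· ψ x i ⟩
    (∑ λ k → ⟪ x , ψ k ⟫ * ψ k i)                 ≈⟨ ∑-cong (λ k → *-congʳ
      (Sampling.reconstruction-coefficient {D = D} B† D† (Bψ k) (BDψ k)
        (trans (ψ⊥ k k) (diagonal-same (λ _ → 1#) k)) (ρσ k) Bx)) ⟨
    (∑ λ k → (ρ k * ⟪ D · x , ψ k ⟫) * ψ k i)     ≈⟨ ∑-cong (λ k → *-congʳ (a≈ k)) ⟨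
    (∑ λ k → a k * ψ k i)                         ∎

open import Defs

-- Complex numbers as a star ring

module ComplexNumbers where
  open import Data.Rational.Properties
  open ≡ using (refl; sym; trans; cong; cong₂; subst; subst₂)
  open ℚ using (ℚ; 0ℚ; 1ℚ; ½; _+_; _*_; _-_; -_; _<_; _≤_; ∣_∣; positive; nonNegative)
  open +-*-Solver
  open ℚ-Facts
  open Reciprocal-Facts
  open Sqrt-Facts

  -- Arithmetic of Cauchy sequences

  Eventually : (ℕ → Set) → Set
  Eventually P = ∃[ M ] (∀ n → M ℕ.≤ n → P n)

  eventually-map : ∀ {P Q : ℕ → Set} → (∀ n → P n → Q n) → Eventually P → Eventually Q
  eventually-map f (M , p) = M , λ n n≥ → f n (p n n≥)

  eventually-zip : ∀ {P Q R : ℕ → Set} → (∀ n → P n → Q n → R n) →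
    Eventually P → Eventually Q → Eventually R
  eventually-zip f (M , p) (L , q) = M ℕ.⊔ L , λ n n≥ →
    f n (p n (ℕₚ.m⊔n≤o⇒m≤o M L n≥)) (q n (ℕₚ.m⊔n≤o⇒n≤o M L n≥))

  ∣p∣²≡p² : ∀ p → ∣ p ∣ * ∣ p ∣ ≡ p * p
  ∣p∣²≡p² p with ∣p∣≡p∨∣p∣≡-p p
  ... | inj₁ e = cong₂ _*_ e e
  ... | inj₂ e = trans (cong₂ _*_ e e) (solve 1 (λ p → (:- p) :* (:- p) := p :* p) refl p)

  0≤p² : ∀ p → 0ℚ ≤ p * p
  0≤p² p = subst (0ℚ ≤_) (∣p∣²≡p² p) (*-mono-≤₀ {0ℚ} {∣ p ∣} {0ℚ} {∣ p ∣} ≤-refl (0≤∣p∣ p) (0≤∣p∣ p) (0≤∣p∣ p))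

  -- Agreement is asked only from some index on, because a reciprocal may hold the default value of
  -- `invℚ` on an initial segment.
  ≈ℝ-eventually : ∀ x y → Eventually (λ n → seq x n ≡ seq y n) → x ≈ℝ y
  ≈ℝ-eventually x y e ε ε>0 = eventually-map (λ n xₙ≡yₙ → subst (λ z → ∣ seq x n - z ∣ < ε) xₙ≡yₙ
    (subst (λ z → ∣ z ∣ < ε) (sym (+-inverseʳ (seq x n))) ε>0)) e

  ≈ℝ-pointwise : ∀ x y → (∀ n → seq x n ≡ seq y n) → x ≈ℝ y
  ≈ℝ-pointwise x y e = ≈ℝ-eventually x y (0 , λ n _ → e n)

  -- The arguments stay explicit: _≈ℝ_ unfolds to a statement about seq x and seq y only, from which
  -- x and y cannot be inferred.
  ≈ℝ-sym : ∀ x y → x ≈ℝ y → y ≈ℝ x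
  ≈ℝ-sym x y e ε ε>0 =
    eventually-map (λ n → subst (_< ε) (∣p-q∣≡∣q-p∣ (seq x n) (seq y n))) (e ε ε>0)

  ∣p+q∣<ε : ∀ {p q r ε} → p + q ≡ r → ∣ p ∣ < ½ * ε → ∣ q ∣ < ½ * ε → ∣ r ∣ < ε
  ∣p+q∣<ε {p} {q} {ε = ε} refl p< q< =
    subst (∣ p + q ∣ <_) (½+½ ε) (≤-<-trans (∣p+q∣≤∣p∣+∣q∣ p q) (+-mono-< p< q<))

  ≈ℝ-trans : ∀ x y z → x ≈ℝ y → y ≈ℝ z → x ≈ℝ z
  ≈ℝ-trans x y z e f ε ε>0 = eventually-zip
    (λ n → ∣p+q∣<ε (solve 3 (λ a b c → (a :+ :- b) :+ (b :+ :- c) := a :+ :- c) refl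
      (seq x n) (seq y n) (seq z n)))
    (e (½ * ε) (½-pos ε>0)) (f (½ * ε) (½-pos ε>0))

  +ℝ-cong : ∀ w x y z → w ≈ℝ x → y ≈ℝ z → w +ℝ y ≈ℝ x +ℝ z
  +ℝ-cong w x y z e f ε ε>0 = eventually-zip
    (λ n → ∣p+q∣<ε (solve 4 (λ a b c d → (a :+ :- b) :+ (c :+ :- d) := (a :+ c) :+ :- (b :+ d)) refl
      (seq w n) (seq x n) (seq y n) (seq z n)))
    (e (½ * ε) (½-pos ε>0)) (f (½ * ε) (½-pos ε>0))

  -ℝ-cong : ∀ x y → x ≈ℝ y → -ℝ x ≈ℝ -ℝ y
  -ℝ-cong x y e ε ε>0 = eventually-map
    (λ n → subst (_< ε) (trans (∣p-q∣≡∣q-p∣ (seq x n) (seq y n)) (cong ∣_∣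
      (solve 2 (λ a b → b :+ :- a := :- a :+ :- (:- b)) refl (seq x n) (seq y n))))) (e ε ε>0)

  *ℝ-congˡ : ∀ x y z → y ≈ℝ z → x *ℝ y ≈ℝ x *ℝ z
  *ℝ-congˡ x y z e ε ε>0 =
    let (b , b>0 , x≤b) = bounded (seq x) (cauchy x)
    in eventually-zip
      (λ n xₙ≤b d< → subst₂ _<_
        (trans (sym (∣p*q∣≡∣p∣*∣q∣ (seq x n) (seq y n - seq z n)))
          (cong ∣_∣ (solve 3 (λ a b c → a :* (b :+ :- c) := a :* b :+ :- (a :* c)) refl
            (seq x n) (seq y n) (seq z n))))
        (trans (sym (*-assoc b (invℚ b) ε)) (trans
          (cong (λ z → z * ε) (trans (*-comm b (invℚ b)) (invℚ-inverse b>0))) (*-identityˡ ε)))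
        (≤-<-trans (*-monoʳ-≤-nonNeg ∣ seq y n - seq z n ∣ {{∣-∣-nonNeg (seq y n - seq z n)}} xₙ≤b)
                   (*-monoʳ-<-pos b {{positive b>0}} d<)))
      -- As ∣x∣ ≤ b eventually, the tolerance ε / b between y and z becomes ε between the products.
      x≤b (e (invℚ b * ε) (*-pos (invℚ-pos b>0) ε>0))

  *ℝ-cong : ∀ w x y z → w ≈ℝ x → y ≈ℝ z → w *ℝ y ≈ℝ x *ℝ z
  *ℝ-cong w x y z e f = ≈ℝ-trans (w *ℝ y) (w *ℝ z) (x *ℝ z) (*ℝ-congˡ w y z f)
    (≈ℝ-trans (w *ℝ z) (z *ℝ w) (x *ℝ z)
      (≈ℝ-pointwise (w *ℝ z) (z *ℝ w) λ n → *-comm (seq w n) (seq z n))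
    (≈ℝ-trans (z *ℝ w) (z *ℝ x) (x *ℝ z) (*ℝ-congˡ z w x e)
      (≈ℝ-pointwise (z *ℝ x) (x *ℝ z) λ n → *-comm (seq z n) (seq x n))))

  -- Arithmetic and conjugation of complex numbers

  -ℂ_ : ℂ → ℂ
  -ℂ z = (-ℝ re z) +i (-ℝ im z)

  -- Addition, multiplication and negation act term by term on the rational sequences, so each ring
  -- law of ℂ holds exactly at every index and becomes a polynomial identity over ℚ.
  ≈ℂ-pointwise : ∀ w z → (∀ n → seq (re w) n ≡ seq (re z) n) → (∀ n → seq (im w) n ≡ seq (im z) n) →
    w ≈ℂ z
  ≈ℂ-pointwise w z e f = ≈ℝ-pointwise (re w) (re z) e , ≈ℝ-pointwise (im w) (im z) f

  ≈ℂ-refl : ∀ z → z ≈ℂ z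
  ≈ℂ-refl z = ≈ℂ-pointwise z z (λ _ → refl) (λ _ → refl)

  ≈ℂ-sym : ∀ w z → w ≈ℂ z → z ≈ℂ w
  ≈ℂ-sym w z (e , f) = ≈ℝ-sym (re w) (re z) e , ≈ℝ-sym (im w) (im z) f

  ≈ℂ-trans : ∀ v w z → v ≈ℂ w → w ≈ℂ z → v ≈ℂ z
  ≈ℂ-trans v w z (e , f) (g , h) =
    ≈ℝ-trans (re v) (re w) (re z) e g , ≈ℝ-trans (im v) (im w) (im z) f h

  +ℂ-cong : ∀ v w y z → v ≈ℂ w → y ≈ℂ z → v +ℂ y ≈ℂ w +ℂ z
  +ℂ-cong v w y z (e , f) (g , h) =
    +ℝ-cong (re v) (re w) (re y) (re z) e g , +ℝ-cong (im v) (im w) (im y) (im z) f h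

  -ℂ-cong : ∀ w z → w ≈ℂ z → (-ℂ w) ≈ℂ (-ℂ z)
  -ℂ-cong w z (e , f) = -ℝ-cong (re w) (re z) e , -ℝ-cong (im w) (im z) f

  *ℂ-cong : ∀ v w y z → v ≈ℂ w → y ≈ℂ z → v *ℂ y ≈ℂ w *ℂ z
  *ℂ-cong (a +i b) (a′ +i b′) (c +i d) (c′ +i d′) (e , f) (g , h) =
    +ℝ-cong (a *ℝ c) (a′ *ℝ c′) (-ℝ (b *ℝ d)) (-ℝ (b′ *ℝ d′)) (*ℝ-cong a a′ c c′ e g)
      (-ℝ-cong (b *ℝ d) (b′ *ℝ d′) (*ℝ-cong b b′ d d′ f h)) ,
    +ℝ-cong (a *ℝ d) (a′ *ℝ d′) (b *ℝ c) (b′ *ℝ c′) (*ℝ-cong a a′ d d′ e h) (*ℝ-cong b b′ c c′ f g)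

  *ℂ-assoc : ∀ v w z → (v *ℂ w) *ℂ z ≈ℂ v *ℂ (w *ℂ z)
  *ℂ-assoc v w z = ≈ℂ-pointwise ((v *ℂ w) *ℂ z) (v *ℂ (w *ℂ z))
    (λ n → solve 6 (λ a b c d e f →
        (a :* c :+ :- (b :* d)) :* e :+ :- ((a :* d :+ b :* c) :* f)
        := a :* (c :* e :+ :- (d :* f)) :+ :- (b :* (c :* f :+ d :* e))) refl
      (seq (re v) n) (seq (im v) n) (seq (re w) n) (seq (im w) n) (seq (re z) n) (seq (im z) n))
    (λ n → solve 6 (λ a b c d e f →
        (a :* c :+ :- (b :* d)) :* f :+ (a :* d :+ b :* c) :* e
        := a :* (c :* f :+ d :* e) :+ b :* (c :* e :+ :- (d :* f))) refl
      (seq (re v) n) (seq (im v) n) (seq (re w) n) (seq (im w) n) (seq (re z) n) (seq (im z) n))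

  *ℂ-comm : ∀ w z → w *ℂ z ≈ℂ z *ℂ w
  *ℂ-comm w z = ≈ℂ-pointwise (w *ℂ z) (z *ℂ w)
    (λ n → solve 4 (λ a b c d → a :* c :+ :- (b :* d) := c :* a :+ :- (d :* b)) refl
      (seq (re w) n) (seq (im w) n) (seq (re z) n) (seq (im z) n))
    (λ n → solve 4 (λ a b c d → a :* d :+ b :* c := c :* b :+ d :* a) refl
      (seq (re w) n) (seq (im w) n) (seq (re z) n) (seq (im z) n))

  *ℂ-identityˡ : ∀ z → 1ℂ *ℂ z ≈ℂ z
  *ℂ-identityˡ z = ≈ℂ-pointwise (1ℂ *ℂ z) z
    (λ n → solve 2 (λ a b → con 1ℚ :* a :+ :- (con 0ℚ :* b) := a) refl (seq (re z) n) (seq (im z) n))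
    (λ n → solve 2 (λ a b → con 1ℚ :* b :+ con 0ℚ :* a := b) refl (seq (re z) n) (seq (im z) n))

  *ℂ-distribˡ-+ℂ : ∀ v w z → v *ℂ (w +ℂ z) ≈ℂ v *ℂ w +ℂ v *ℂ z
  *ℂ-distribˡ-+ℂ v w z = ≈ℂ-pointwise (v *ℂ (w +ℂ z)) (v *ℂ w +ℂ v *ℂ z)
    (λ n → solve 6 (λ a b c d e f →
        a :* (c :+ e) :+ :- (b :* (d :+ f)) := (a :* c :+ :- (b :* d)) :+ (a :* e :+ :- (b :* f))) refl
      (seq (re v) n) (seq (im v) n) (seq (re w) n) (seq (im w) n) (seq (re z) n) (seq (im z) n))
    (λ n → solve 6 (λ a b c d e f →
        a :* (d :+ f) :+ b :* (c :+ e) := (a :* d :+ b :* c) :+ (a :* f :+ b :* e)) refl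
      (seq (re v) n) (seq (im v) n) (seq (re w) n) (seq (im w) n) (seq (re z) n) (seq (im z) n))

  *ℂ-distribʳ-+ℂ : ∀ v w z → (w +ℂ z) *ℂ v ≈ℂ w *ℂ v +ℂ z *ℂ v
  *ℂ-distribʳ-+ℂ v w z = ≈ℂ-pointwise ((w +ℂ z) *ℂ v) (w *ℂ v +ℂ z *ℂ v)
    (λ n → solve 6 (λ a b c d e f →
        (c :+ e) :* a :+ :- ((d :+ f) :* b) := (c :* a :+ :- (d :* b)) :+ (e :* a :+ :- (f :* b))) refl
      (seq (re v) n) (seq (im v) n) (seq (re w) n) (seq (im w) n) (seq (re z) n) (seq (im z) n))
    (λ n → solve 6 (λ a b c d e f →
        (c :+ e) :* b :+ (d :+ f) :* a := (c :* b :+ d :* a) :+ (e :* b :+ f :* a)) refl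
      (seq (re v) n) (seq (im v) n) (seq (re w) n) (seq (im w) n) (seq (re z) n) (seq (im z) n))

  ℂ-commutativeRing : CommutativeRing 0ℓ 0ℓ
  ℂ-commutativeRing = record
    { Carrier = ℂ ; _≈_ = _≈ℂ_ ; _+_ = _+ℂ_ ; _*_ = _*ℂ_ ; -_ = -ℂ_ ; 0# = 0ℂ ; 1# = 1ℂ
    ; isCommutativeRing = record
      { isRing = record
        { +-isAbelianGroup = record
          { isGroup = record
            { isMonoid = record
              { isSemigroup = record
                { isMagma = record
                  { isEquivalence = isEquivalence
                  ; ∙-cong        = λ {v} {w} {y} {z} → +ℂ-cong v w y z
                  }
                ; assoc = λ v w z → ≈ℂ-pointwise ((v +ℂ w) +ℂ z) (v +ℂ (w +ℂ z))
                    (λ n → +-assoc (seq (re v) n) (seq (re w) n) (seq (re z) n))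
                    (λ n → +-assoc (seq (im v) n) (seq (im w) n) (seq (im z) n))
                }
              ; identity = comm∧idˡ⇒id {_∙_ = _+ℂ_} +ℂ-comm {e = 0ℂ} λ z → ≈ℂ-pointwise (0ℂ +ℂ z) z
                  (λ n → +-identityˡ (seq (re z) n)) (λ n → +-identityˡ (seq (im z) n))
              }
            ; inverse = comm∧invˡ⇒inv {_∙_ = _+ℂ_} { -ℂ_} {0ℂ} +ℂ-comm λ z → ≈ℂ-pointwise ((-ℂ z) +ℂ z) 0ℂ
                (λ n → +-inverseˡ (seq (re z) n)) (λ n → +-inverseˡ (seq (im z) n))
            ; ⁻¹-cong = λ {w} {z} → -ℂ-cong w z
            }
          ; comm = +ℂ-comm
          }
        ; *-cong = λ {v} {w} {y} {z} → *ℂ-cong v w y z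
        ; *-assoc = *ℂ-assoc
        ; *-identity = comm∧idˡ⇒id {_∙_ = _*ℂ_} *ℂ-comm {e = 1ℂ} *ℂ-identityˡ
        ; distrib = *ℂ-distribˡ-+ℂ , *ℂ-distribʳ-+ℂ
        }
      ; *-comm = *ℂ-comm
      }
    }
    where
    isEquivalence : IsEquivalence _≈ℂ_
    isEquivalence = record
      { refl  = λ {z} → ≈ℂ-refl z
      ; sym   = λ {w} {z} → ≈ℂ-sym w z
      ; trans = λ {v} {w} {z} → ≈ℂ-trans v w z
      }
    setoid : Setoid 0ℓ 0ℓ
    setoid = record { isEquivalence = isEquivalence }
    open SetoidConsequences setoid using (comm∧idˡ⇒id; comm∧invˡ⇒inv)
    +ℂ-comm : ∀ w z → w +ℂ z ≈ℂ z +ℂ w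
    +ℂ-comm w z = ≈ℂ-pointwise (w +ℂ z) (z +ℂ w)
      (λ n → +-comm (seq (re w) n) (seq (re z) n)) (λ n → +-comm (seq (im w) n) (seq (im z) n))

  conj-isStarRing : IsStarRing ℂ-commutativeRing conj
  conj-isStarRing = record
    { †-cong       = λ {w} {z} (e , f) → e , -ℝ-cong (im w) (im z) f
    ; †-homo-+     = λ w z → ≈ℂ-pointwise (conj (w +ℂ z)) (conj w +ℂ conj z) (λ _ → refl)
        (λ n → neg-distrib-+ (seq (im w) n) (seq (im z) n))
    ; †-homo-*     = λ w z → ≈ℂ-pointwise (conj (w *ℂ z)) (conj w *ℂ conj z)
        (λ n → solve 4 (λ a b c d → a :* c :+ :- (b :* d) := a :* c :+ :- ((:- b) :* (:- d))) refl
          (seq (re w) n) (seq (im w) n) (seq (re z) n) (seq (im z) n))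
        (λ n → solve 4 (λ a b c d → :- (a :* d :+ b :* c) := a :* (:- d) :+ (:- b) :* c) refl
          (seq (re w) n) (seq (im w) n) (seq (re z) n) (seq (im z) n))
    ; †-homo-0     = ≈ℂ-pointwise (conj 0ℂ) 0ℂ (λ _ → refl) (λ _ → refl)
    ; †-homo-1     = ≈ℂ-pointwise (conj 1ℂ) 1ℂ (λ _ → refl) (λ _ → refl)
    ; †-involutive = λ z → ≈ℂ-pointwise (conj (conj z)) z (λ _ → refl)
        (λ n → solve 1 (λ a → :- (:- a) := a) refl (seq (im z) n))
    }

  Vecℂ-isMatrixCalculus : IsMatrixCalculus ℂ-commutativeRing conj ∑ℂ _·_ ⟨_,_⟩
  Vecℂ-isMatrixCalculus = record
    { ∑-empty = λ t → ≈ℂ-pointwise (∑ℂ t) 0ℂ (λ _ → refl) (λ _ → refl)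
    ; ∑-suc   = λ t → ≈ℂ-pointwise (∑ℂ t) (t zero +ℂ ∑ℂ (λ i → t (suc i))) (λ _ → refl) (λ _ → refl)
    ; ·-def   = λ A x i → ≈ℂ-pointwise ((A · x) i) (∑ℂ (λ j → A i j *ℂ x j)) (λ _ → refl) (λ _ → refl)
    ; ⟪⟫-def  = λ x y → ≈ℂ-pointwise ⟨ x , y ⟩ (∑ℂ (λ i → conj (y i) *ℂ x i)) (λ _ → refl) (λ _ → refl)
    }

  w-z+z≈w : ∀ w z → (w -ℂ z) +ℂ z ≈ℂ w
  w-z+z≈w w z = ≈ℂ-pointwise ((w -ℂ z) +ℂ z) w
    (λ n → solve 2 (λ a b → (a :+ :- b) :+ b := a) refl (seq (re w) n) (seq (re z) n))
    (λ n → solve 2 (λ a b → (a :+ :- b) :+ b := a) refl (seq (im w) n) (seq (im z) n))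

open ComplexNumbers

open StarLinearAlgebra ℂ-commutativeRing conj conj-isStarRing ∑ℂ _·_ ⟨_,_⟩ Vecℂ-isMatrixCalculus
  using (frobenius; Hermitian; outer; diagonal; diagonal-same; diagonal-hermitian; indicator;
         indicator-idempotent; indicator-selfAdjoint; ∑-indicator; IsProduct; product-·; ·-congˡ;
         ⟪⟫-scaled-unit; ≈outer⇒hermitian; ≈outer⇒frobenius; equal-trace⇒equal; reconstruction;
         module Band; module Sampling)

-- Positivity and norm estimates

module Estimates where
  open import Data.Rational.Properties
  open ≡ using (refl; sym; trans; cong; cong₂; subst; subst₂)
  open ℚ using (ℚ; 0ℚ; 1ℚ; ½; _+_; _*_; _-_; -_; _<_; _≤_; ∣_∣; positive; nonNegative)
  open +-*-Solver
  open ℚ-Facts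
  open Reciprocal-Facts
  open Sqrt-Facts

  *-conj-re : ∀ a b → a * a - b * (- b) ≡ a * a + b * b
  *-conj-re = solve 2 (λ a b → a :* a :+ :- (b :* (:- b)) := a :* a :+ b :* b) refl

  ∑ℂ-nonNeg : ∀ {m} (t : Fin m → ℂ) n → (∀ i → 0ℚ ≤ seq (re (t i)) n) → 0ℚ ≤ seq (re (∑ℂ t)) n
  ∑ℂ-nonNeg {ℕ.zero}  t n 0≤t = ≤-refl
  ∑ℂ-nonNeg {ℕ.suc m} t n 0≤t = +-mono-≤ (0≤t zero) (∑ℂ-nonNeg (λ i → t (suc i)) n λ i → 0≤t (suc i))

  term≤∑ℂ : ∀ {m} (t : Fin m → ℂ) n → (∀ i → 0ℚ ≤ seq (re (t i)) n) →
    ∀ i → seq (re (t i)) n ≤ seq (re (∑ℂ t)) n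
  term≤∑ℂ t n 0≤t zero    = subst (_≤ seq (re (∑ℂ t)) n) (+-identityʳ (seq (re (t zero)) n))
    (+-monoʳ-≤ (seq (re (t zero)) n) (∑ℂ-nonNeg (λ i → t (suc i)) n λ i → 0≤t (suc i)))
  term≤∑ℂ t n 0≤t (suc i) = ≤-trans (term≤∑ℂ (λ i → t (suc i)) n (λ i → 0≤t (suc i)) i)
    (subst (_≤ seq (re (∑ℂ t)) n) (+-identityˡ (seq (re (∑ℂ (λ i → t (suc i)))) n))
      (+-monoˡ-≤ (seq (re (∑ℂ (λ i → t (suc i)))) n) (0≤t zero)))

  -- If ε ≤ ∣xₙ∣ then ε² ≤ xₙ² ≤ yₙ, which is excluded as soon as y is within ε² of 0.
  square≤⇒≈0 : ∀ x y → (∀ n → seq x n * seq x n ≤ seq y n) → y ≈ℝ 0ℝ → x ≈ℝ 0ℝ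
  square≤⇒≈0 x y x²≤y y≈0 ε ε>0 = eventually-map
    (λ n y< → subst (λ z → ∣ z ∣ < ε) (sym (+-identityʳ (seq x n))) (≰⇒> λ ε≤x →
      <-irrefl refl (≤-<-trans
        (≤-trans (*-mono-≤₀ (<⇒≤ ε>0) (0≤∣p∣ (seq x n)) ε≤x ε≤x)
          (≤-trans (≤-reflexive (∣p∣²≡p² (seq x n))) (x²≤y n)))
        (∣p∣<q⇒ (subst (λ z → ∣ z ∣ < ε * ε) (+-identityʳ (seq y n)) y<)))))
    (y≈0 (ε * ε) (*-pos ε>0 ε>0))

  -- At every index of the sequences, the norm is a sum of nonnegative rationals and dominates the
  -- squared real and imaginary part of each entry.
  frobenius-definite : ∀ {n} (Q : Matℂ n) → frobenius Q Q ≈ℂ 0ℂ → ∀ i j → Q i j ≈ℂ 0ℂ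
  frobenius-definite {n} Q (∥Q∥²≈0 , _) i j =
    square≤⇒≈0 (re (Q i j)) (re (frobenius Q Q))
      (λ k → ≤-trans (p≤p+q (0≤p² (seq (im (Q i j)) k))) (bound k)) ∥Q∥²≈0 ,
    square≤⇒≈0 (im (Q i j)) (re (frobenius Q Q))
      (λ k → ≤-trans (p≤q+p (0≤p² (seq (re (Q i j)) k))) (bound k)) ∥Q∥²≈0
    where
    p≤p+q : ∀ {p q} → 0ℚ ≤ q → p ≤ p + q
    p≤p+q {p} {q} h = subst (_≤ p + q) (+-identityʳ p) (+-monoʳ-≤ p h)
    p≤q+p : ∀ {p q} → 0ℚ ≤ q → p ≤ q + p
    p≤q+p {p} {q} h = subst (p ≤_) (+-comm p q) (p≤p+q h)
    entry : Fin n → Fin n → ℂ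
    entry i j = Q i j *ℂ conj (Q i j)
    0≤entry : ∀ k i j → 0ℚ ≤ seq (re (entry i j)) k
    0≤entry k i j = subst (0ℚ ≤_) (sym (*-conj-re (seq (re (Q i j)) k) (seq (im (Q i j)) k)))
      (+-mono-≤ (0≤p² (seq (re (Q i j)) k)) (0≤p² (seq (im (Q i j)) k)))
    bound : ∀ k → seq (re (Q i j)) k * seq (re (Q i j)) k + seq (im (Q i j)) k * seq (im (Q i j)) k
      ≤ seq (re (frobenius Q Q)) k
    bound k = subst (_≤ seq (re (frobenius Q Q)) k) (*-conj-re (seq (re (Q i j)) k) (seq (im (Q i j)) k))
      (≤-trans (term≤∑ℂ (entry i) k (0≤entry k i) j)
               (term≤∑ℂ (λ i → ∑ℂ (entry i)) k (λ i → ∑ℂ-nonNeg (entry i) k (0≤entry k i)) i))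

  -- The imaginary part cancels at every index. The real part is `invℚ` of ∣z∣² times ∣z∣², which is
  -- known to be 1 only from the index M on, where the witness ε of apartness keeps ∣z∣² positive.
  recipℂ-inverseˡ : ∀ z (z≠0 : NonZeroℂ z) → recipℂ z z≠0 *ℂ z ≈ℂ 1ℂ
  recipℂ-inverseˡ z z≠0@(ε , ε>0 , M , ε<∣z∣²) =
    ≈ℝ-eventually (re (recipℂ z z≠0 *ℂ z)) 1ℝ (M , λ n n≥ → trans
      (real-part (seq (re z) n) (seq (im z) n) (invℚ (seq ∣ z ∣² n)))
      (invℚ-inverse (<-trans ε>0 (subst (_< seq ∣ z ∣² n) (+-identityˡ ε) (ε<∣z∣² n n≥))))) ,
    ≈ℝ-pointwise (im (recipℂ z z≠0 *ℂ z)) 0ℝ (λ n →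
      imaginary-part (seq (re z) n) (seq (im z) n) (invℚ (seq ∣ z ∣² n)))
    where
    real-part : ∀ a b r → (a * r) * a - ((- b) * r) * b ≡ r * (a * a + b * b)
    real-part = solve 3 (λ a b r → (a :* r) :* a :+ :- (((:- b) :* r) :* b) := r :* (a :* a :+ b :* b)) refl
    imaginary-part : ∀ a b r → (a * r) * b + ((- b) * r) * a ≡ 0ℚ
    imaginary-part = solve 3 (λ a b r → (a :* r) :* b :+ ((:- b) :* r) :* a := con 0ℚ) refl

  ∑ℝ≡re∑ℂ : ∀ {m} (s : Fin m → ℝ) (t : Fin m → ℂ) n → (∀ i → seq (s i) n ≡ seq (re (t i)) n) →
    seq (∑ℝ s) n ≡ seq (re (∑ℂ t)) n
  ∑ℝ≡re∑ℂ {ℕ.zero}  s t n e = refl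
  ∑ℝ≡re∑ℂ {ℕ.suc m} s t n e =
    cong₂ _+_ (e zero) (∑ℝ≡re∑ℂ (λ i → s (suc i)) (λ i → t (suc i)) n (λ i → e (suc i)))

  ∑∣∣²≡⟨⟩ : ∀ {m} (v : Vecℂ m) n → seq (∑ℝ (λ i → ∣ v i ∣²)) n ≡ seq (re ⟨ v , v ⟩) n
  ∑∣∣²≡⟨⟩ v n = ∑ℝ≡re∑ℂ (λ i → ∣ v i ∣²) (λ i → conj (v i) *ℂ v i) n
    (λ i → conj-*-re (seq (re (v i)) n) (seq (im (v i)) n))
    where
    conj-*-re : ∀ a b → a * a + b * b ≡ a * a - (- b) * b
    conj-*-re = solve 2 (λ a b → a :* a :+ b :* b := a :* a :+ :- ((:- b) :* b)) refl

  p≤p² : ∀ {p} → 1ℚ ≤ p → p ≤ p * p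
  p≤p² {p} 1≤p = subst (_≤ p * p) (*-identityˡ p)
    (*-monoʳ-≤-nonNeg p {{nonNegative (≤-trans (<⇒≤ 0<1) 1≤p)}} 1≤p)

  -- The rational root r rounds down, so r² ≤ ∣xₙ∣. From 1 + ε ≤ r it would follow that 1 + ε ≤ (1 +
  -- ε)² ≤ ∣xₙ∣ < 1 + ε.
  sqrtℝ-≤1 : ∀ x → x ≈ℝ 1ℝ → sqrtℝ x ≤ℝ 1ℝ
  sqrtℝ-≤1 x x≈1 ε ε>0 = eventually-map (λ n ∣x-1∣<ε → ≰⇒> λ 1+ε≤r → <-irrefl refl (begin-strict
    1ℚ + ε                                  ≤⟨ p≤p² (<⇒≤ 1<1+ε) ⟩
    (1ℚ + ε) * (1ℚ + ε)                     ≤⟨ *-mono-≤₀ (<⇒≤ 0<1+ε) (sqrtℚ-nonNeg n (seq x n)) 1+ε≤r 1+ε≤r ⟩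
    sqrtℚ n (seq x n) * sqrtℚ n (seq x n)   ≤⟨ sqrtℚ-lower n (seq x n) ⟩
    ∣ seq x n ∣                             ≡⟨ cong ∣_∣ (solve 1 (λ x → x := con 1ℚ :+ (x :+ :- con 1ℚ)) refl (seq x n)) ⟩
    ∣ 1ℚ + (seq x n - 1ℚ) ∣                 ≤⟨ ∣p+q∣≤∣p∣+∣q∣ 1ℚ (seq x n - 1ℚ) ⟩
    1ℚ + ∣ seq x n - 1ℚ ∣                   <⟨ +-monoʳ-< 1ℚ ∣x-1∣<ε ⟩
    1ℚ + ε                                  ∎)) (x≈1 ε ε>0)
    where
    open ≤-Reasoning
    1<1+ε : 1ℚ < 1ℚ + ε
    1<1+ε = p<p+q 1ℚ ε>0
    0<1+ε : 0ℚ < 1ℚ + ε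
    0<1+ε = <-trans 0<1 1<1+ε

  -- Rounding loses less than one unit, so c = root + unit satisfies x < c². Once c < 1 also c² ≤ c,
  -- and the gap below 1 survives squaring.
  sqrtℝ<1⇒<1 : ∀ x s → sqrtℝ x ≤ℝ s → s <ℝ 1ℝ → x <ℝ 1ℝ
  sqrtℝ<1⇒<1 x s √x≤s (ε , ε>0 , s+ε<1) =
    θ , θ>0 , eventually-zip step
      (eventually-zip (λ n → _,_) (√x≤s (½ * ε) (½-pos ε>0)) (unit-small θ θ>0)) s+ε<1
    where
    open ≤-Reasoning
    -- Half of ε pays for √x ≤ s; of the two quarters θ that remain, one bounds the rounding unit
    -- and the other is the final gap.
    θ : ℚ
    θ = ½ * (½ * ε)
    θ>0 : 0ℚ < θ
    θ>0 = ½-pos (½-pos ε>0)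
    step : ∀ n → (sqrtℚ n (seq x n) < seq s n + ½ * ε) × (unit n ≤ θ) → seq s n + ε < 1ℚ → seq x n + θ < 1ℚ
    step n (r< , u≤) s< = begin-strict
      seq x n + θ     ≤⟨ +-monoˡ-≤ θ (<⇒≤ (∣p∣<q⇒ (sqrtℚ-upper n (seq x n)))) ⟩
      c * c + θ       ≤⟨ +-monoˡ-≤ θ (*-monoʳ-≤-nonNeg c {{nonNegative 0≤c}} (<⇒≤ c<1)) ⟩
      1ℚ * c + θ      ≡⟨ cong (_+ θ) (*-identityˡ c) ⟩
      c + θ           <⟨ c+θ<1 ⟩
      1ℚ              ∎
      where
      c : ℚ
      c = sqrtℚ n (seq x n) + unit n
      0≤c : 0ℚ ≤ c
      0≤c = +-mono-≤ (sqrtℚ-nonNeg n (seq x n)) (<⇒≤ (unit-pos n))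
      c+θ<1 : c + θ < 1ℚ
      c+θ<1 = begin-strict
        c + θ                     <⟨ +-monoˡ-< θ (+-mono-<-≤ r< u≤) ⟩
        (seq s n + ½ * ε + θ) + θ ≡⟨ solve 2 (λ s e →
                                       (s :+ con ½ :* e :+ con ½ :* (con ½ :* e)) :+ con ½ :* (con ½ :* e) := s :+ e) refl (seq s n) ε ⟩
        seq s n + ε               <⟨ s< ⟩
        1ℚ                        ∎
      c<1 : c < 1ℚ
      c<1 = <-trans (p<p+q c θ>0) c+θ<1

  -- ∣1 − z∣² = 1 − 2 re z + ∣z∣², so ∣1 − z∣² < 1 forces re z > 0.
  ∣1-z∣²<1⇒nonZero : ∀ z x → x ≈ℝ re ((1ℂ -ℂ z) *ℂ conj (1ℂ -ℂ z)) → x <ℝ 1ℝ → NonZeroℂ z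
  ∣1-z∣²<1⇒nonZero z x x≈ (ε , ε>0 , x+ε<1) =
    η * η , *-pos η>0 η>0 , eventually-zip step (x≈ (½ * ε) (½-pos ε>0)) x+ε<1
    where
    open ≤-Reasoning
    -- Half of ε absorbs the difference between x and ∣1 - z∣². What is left, 1 - 2 re z ≤ ∣1 - z∣²
    -- < 1 - ε/2, gives re z > ε/4 = η, so η² is a lower bound for ∣z∣².
    η : ℚ
    η = ½ * (½ * ε)
    η>0 : 0ℚ < η
    η>0 = ½-pos (½-pos ε>0)
    step : ∀ n → ∣ seq x n - seq (re ((1ℂ -ℂ z) *ℂ conj (1ℂ -ℂ z))) n ∣ < ½ * ε →
      seq x n + ε < 1ℚ → 0ℚ + η * η < seq ∣ z ∣² n
    step n x-c< x+ε< = begin-strict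
      0ℚ + η * η    ≡⟨ +-identityˡ (η * η) ⟩
      η * η         <⟨ *-monoʳ-<-pos η {{positive η>0}} η<p ⟩
      η * p         ≤⟨ *-monoʳ-≤-nonNeg p {{nonNegative (<⇒≤ (<-trans η>0 η<p))}} (<⇒≤ η<p) ⟩
      p * p         ≡⟨ +-identityʳ (p * p) ⟨
      p * p + 0ℚ    ≤⟨ +-monoʳ-≤ (p * p) (0≤p² q) ⟩
      p * p + q * q ∎
      where
      p q c : ℚ
      p = seq (re z) n
      q = seq (im z) n
      c = seq (re ((1ℂ -ℂ z) *ℂ conj (1ℂ -ℂ z))) n
      c+½ε<1 : c + ½ * ε < 1ℚ
      c+½ε<1 = begin-strict
        c + ½ * ε                         ≡⟨ solve 3 (λ c x e →
                                               c :+ con ½ :* e := (c :+ :- x) :+ (x :+ con ½ :* e)) refl c (seq x n) ε ⟩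
        (c - seq x n) + (seq x n + ½ * ε) <⟨ +-monoˡ-< (seq x n + ½ * ε)
                                               (∣p∣<q⇒ (subst (_< ½ * ε) (∣p-q∣≡∣q-p∣ (seq x n) c) x-c<)) ⟩
        ½ * ε + (seq x n + ½ * ε)         ≡⟨ solve 2 (λ x e → con ½ :* e :+ (x :+ con ½ :* e) := x :+ e) refl (seq x n) ε ⟩
        seq x n + ε                       <⟨ x+ε< ⟩
        1ℚ                                ∎
      η<p : η < p
      η<p = ≰⇒> λ p≤η → <-irrefl refl (begin-strict
        1ℚ                                  ≡⟨ solve 1 (λ e →
                                                 con 1ℚ := (con 1ℚ :+ :- (con ½ :* (con ½ :* e) :+ con ½ :* (con ½ :* e))) :+ con ½ :* e) refl ε ⟩
        (1ℚ - (η + η)) + ½ * ε              ≤⟨ +-monoˡ-≤ (½ * ε) (+-monoʳ-≤ 1ℚ (neg-antimono-≤ (+-mono-≤ p≤η p≤η))) ⟩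
        (1ℚ - (p + p)) + ½ * ε              ≡⟨ cong (_+ ½ * ε) (+-identityʳ (1ℚ - (p + p))) ⟨
        ((1ℚ - (p + p)) + 0ℚ) + ½ * ε       ≤⟨ +-monoˡ-≤ (½ * ε) (+-monoʳ-≤ (1ℚ - (p + p)) (+-mono-≤ (0≤p² p) (0≤p² q))) ⟩
        -- The target is c as it unfolds: the imaginary part of 1 - z is 0 - q, and the other signs
        -- come from conjugation and complex multiplication.
        ((1ℚ - (p + p)) + (p * p + q * q)) + ½ * ε ≡⟨ cong (_+ ½ * ε) (solve 2 (λ p q →
            (con 1ℚ :+ :- (p :+ p)) :+ (p :* p :+ q :* q)
            := (con 1ℚ :+ :- p) :* (con 1ℚ :+ :- p) :+ :- ((con 0ℚ :+ :- q) :* (:- (con 0ℚ :+ :- q)))) refl p q) ⟩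
        c + ½ * ε                           <⟨ c+½ε<1 ⟩
        1ℚ                                  ∎)

open Estimates
open import Data.Fin.Subset using (Subset; ∣_∣)

-- Sampling of band-limited signals

*ₘ-isProduct : ∀ {N} (A C : Matℂ N) → IsProduct (A *ₘ C) A C
*ₘ-isProduct A C i k =
  ≈ℂ-pointwise ((A *ₘ C) i k) (∑ℂ (λ j → A i j *ℂ C j k)) (λ _ → ≡.refl) (λ _ → ≡.refl)

*ₘ-· : ∀ {N} (A C : Matℂ N) x → (A *ₘ C) · x ≈ᵥ A · (C · x)
*ₘ-· A C = product-· {E = A *ₘ C} {A} {C} (*ₘ-isProduct A C)

∑∣∣²≈⟨⟩ : ∀ {N} (v : Vecℂ N) z → ⟨ v , v ⟩ ≈ℂ z → ∑ℝ (λ i → ∣ v i ∣²) ≈ℝ re z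
∑∣∣²≈⟨⟩ v z (e , _) = ≈ℝ-trans (∑ℝ (λ i → ∣ v i ∣²)) (re ⟨ v , v ⟩) (re z)
  (≈ℝ-pointwise (∑ℝ (λ i → ∣ v i ∣²)) (re ⟨ v , v ⟩) (∑∣∣²≡⟨⟩ v)) e

∥∥-unit : ∀ {N} (v : Vecℂ N) → ⟨ v , v ⟩ ≈ℂ 1ℂ → ∥ v ∥ ≤ℝ 1ℝ
∥∥-unit v vv = sqrtℝ-≤1 (∑ℝ (λ i → ∣ v i ∣²)) (∑∣∣²≈⟨⟩ v 1ℂ vv)

∥∥≈∥∥ : ∀ {N} (v : Vecℂ N) → ∥ v ∥ ≈ℝ ∥ v ∥
∥∥≈∥∥ v = ≈ℝ-pointwise ∥ v ∥ ∥ v ∥ (λ _ → ≡.refl)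

-- For a unit vector ψ the norm of r is ∣1 - z∣, so z lies within a distance bounded below 1 from
-- the point 1, hence away from 0.
residual<1⇒nonZero : ∀ {N} (r ψ : Vecℂ N) z s → ⟨ ψ , ψ ⟩ ≈ℂ 1ℂ → r ≈ᵥ (1ℂ -ℂ z) • ψ →
  ∥ r ∥ ≤ℝ s → s <ℝ 1ℝ → NonZeroℂ z
residual<1⇒nonZero r ψ z s ψψ r≈ ∥r∥≤s s<1 = ∣1-z∣²<1⇒nonZero z (∑ℝ (λ i → ∣ r i ∣²))
  (∑∣∣²≈⟨⟩ r ((1ℂ -ℂ z) *ℂ conj (1ℂ -ℂ z)) (⟪⟫-scaled-unit {a = 1ℂ -ℂ z} {r} {ψ} r≈ ψψ))
  (sqrtℝ<1⇒<1 (∑ℝ (λ i → ∣ r i ∣²)) s ∥r∥≤s s<1)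

module BandLimiting {N} (U : Matℂ N) (F : Subset N) where
  open Band {U = U} {U *} {indicatorMatrix F} {U *ₘ indicatorMatrix F} {bandLimiting U F} {indicator F}
    (λ i j → ≈ℂ-refl (conj (U j i))) (λ i j → ≈ℂ-refl (indicatorMatrix F i j))
    (*ₘ-isProduct U (indicatorMatrix F)) (*ₘ-isProduct (U *ₘ indicatorMatrix F) (U *))
    (indicator-idempotent F) (indicator-selfAdjoint F)

  bandLimiting-hermitian : Hermitian (bandLimiting U F)
  bandLimiting-hermitian = ≈outer⇒hermitian {A = bandLimiting U F} bandVector band≈outer

  frobenius-bandLimiting : IsUnitary U →
    frobenius (bandLimiting U F) (bandLimiting U F) ≈ℂ ∑ℂ {∣ F ∣} (λ _ → 1ℂ)
  frobenius-bandLimiting (U*U≈I , _) =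
    ≈ℂ-trans (frobenius (bandLimiting U F) (bandLimiting U F)) (∑ℂ (indicator F)) (∑ℂ {∣ F ∣} (λ _ → 1ℂ))
      (≈outer⇒frobenius {A = bandLimiting U F} bandVector (indicator-idempotent F)
        (bandVector-orthogonal {U * *ₘ U} (*ₘ-isProduct (U *) U) U*U≈I) band≈outer)
      (∑-indicator F)

-- The band-limiting operator is abstracted to a Hermitian B with squared Hilbert-Schmidt norm K.
-- Together with K orthonormal vectors fixed by B, this determines B as the projection onto their
-- span.
module HermitianSampling {N K} (B D : Matℂ N) (B† : Hermitian B) (D† : Hermitian D)
    (∥B∥² : frobenius B B ≈ℂ ∑ℂ {K} (λ _ → 1ℂ))
    (ψ : Fin K → Vecℂ N) (σ² : Fin K → ℂ) (ψ⊥ : IsOrthonormal ψ)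
    (Bψ : ∀ k → B · ψ k ≈ᵥ ψ k)
    (BDBψ : ∀ k → (B *ₘ D *ₘ B) · ψ k ≈ᵥ σ² k • ψ k) where

  ⟨ψ,ψ⟩≈1 : ∀ k → ⟨ ψ k , ψ k ⟩ ≈ℂ 1ℂ
  ⟨ψ,ψ⟩≈1 k = ≈ℂ-trans ⟨ ψ k , ψ k ⟩ (diagonal (λ _ → 1ℂ) k k) 1ℂ (ψ⊥ k k)
    (diagonal-same (λ _ → 1ℂ) k)

  -- Since Bψ = ψ, the inner factor B of BDB disappears on ψ.
  BDψ : ∀ k → B · (D · ψ k) ≈ᵥ σ² k • ψ k
  BDψ k i = ≈ℂ-trans ((B · (D · ψ k)) i) (((B *ₘ D *ₘ B) · ψ k) i) (σ² k *ℂ ψ k i)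
    (≈ℂ-sym (((B *ₘ D *ₘ B) · ψ k) i) ((B · (D · ψ k)) i)
      (≈ℂ-trans (((B *ₘ D *ₘ B) · ψ k) i) (((B *ₘ D) · (B · ψ k)) i) ((B · (D · ψ k)) i)
        (*ₘ-· (B *ₘ D) B (ψ k) i)
        (≈ℂ-trans (((B *ₘ D) · (B · ψ k)) i) (((B *ₘ D) · ψ k) i) ((B · (D · ψ k)) i)
          (·-congˡ (B *ₘ D) {B · ψ k} {ψ k} (Bψ k) i)
          (*ₘ-· B D (ψ k) i))))
    (BDBψ k i)

  residual≈ : ∀ k → (B *ₘ (I -ₘ D)) · ψ k ≈ᵥ (1ℂ -ℂ σ² k) • ψ k
  residual≈ k i = ≈ℂ-trans (((B *ₘ (I -ₘ D)) · ψ k) i) ((B · ((I -ₘ D) · ψ k)) i) ((1ℂ -ℂ σ² k) *ℂ ψ k i)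
      (*ₘ-· B (I -ₘ D) (ψ k) i)
      (Sampling.residual-· {B = B} {D} B† D† {σ² k} {ψ k} (Bψ k) (BDψ k) {I -ₘ D} {1ℂ -ℂ σ² k}
        (λ i j → w-z+z≈w (I i j) (D i j)) (w-z+z≈w 1ℂ (σ² k)) i)

  eigenvalue-nonZero : ∀ s → IsSpectralNorm (B *ₘ (I -ₘ D)) s → s <ℝ 1ℝ → ∀ k → NonZeroℂ (σ² k)
  eigenvalue-nonZero s (upper , _) s<1 k =
    residual<1⇒nonZero ((B *ₘ (I -ₘ D)) · ψ k) (ψ k) (σ² k) s (⟨ψ,ψ⟩≈1 k) (residual≈ k)
      -- ψₖ lies in the unit ball, so the supremum bounds the norm of its image under B D̄.
      (upper ∥ (B *ₘ (I -ₘ D)) · ψ k ∥ (ψ k , ∥∥-unit (ψ k) (⟨ψ,ψ⟩≈1 k) ,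
        ∥∥≈∥∥ ((B *ₘ (I -ₘ D)) · ψ k))) s<1

  B≈outer : ∀ i j → B i j ≈ℂ outer ψ i j
  B≈outer = equal-trace⇒equal {A = B} {ψ} frobenius-definite ψ⊥ Bψ ∥B∥²

  reconstruct : (σ²≠0 : ∀ k → NonZeroℂ (σ² k)) → ∀ x → B · x ≈ᵥ x →
    x ≈ᵥ ∑ᵥ (λ k → (recipℂ (σ² k) (σ²≠0 k) *ℂ ⟨ D · x , ψ k ⟩) • ψ k)
  reconstruct σ²≠0 x Bx = reconstruction {B = B} {D} B† D† ψ σ²
    (λ k → recipℂ (σ² k) (σ²≠0 k)) ψ⊥ Bψ BDψ (λ k → recipℂ-inverseˡ (σ² k) (σ²≠0 k)) B≈outer x Bx
    (λ k → recipℂ (σ² k) (σ²≠0 k) *ℂ ⟨ D · x , ψ k ⟩)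
    (λ k → ≈ℂ-refl (recipℂ (σ² k) (σ²≠0 k) *ℂ ⟨ D · x , ψ k ⟩))

-- The reciprocal of σᵢ² takes a proof of apartness from 0, so these proofs are delivered together
-- with the formula instead of being assumed.
mainTheorem6 : ∀ (N : ℕ) (U : Matℂ N) → IsUnitary U →
    ∀ (S F : Subset N) →
    let D  = indicatorMatrix S
        D̄  = I -ₘ D
        B  = bandLimiting U F
    in
    ∀ (s : ℝ) → IsSpectralNorm (B *ₘ D̄) s → s <ℝ 1ℝ →
    ∀ (ψ : Fin ∣ F ∣ → Vecℂ N) (σ² : Fin ∣ F ∣ → ℂ) →
    IsOrthonormal ψ →
    (∀ i → B · ψ i ≈ᵥ ψ i) →
    (∀ i → (B *ₘ D *ₘ B) · ψ i ≈ᵥ σ² i • ψ i) →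
    Σ[ σ²≠0 ∈ (∀ i → NonZeroℂ (σ² i)) ]
      (∀ (x : Vecℂ N) → B · x ≈ᵥ x →
        x ≈ᵥ ∑ᵥ (λ i → (recipℂ (σ² i) (σ²≠0 i) *ℂ ⟨ D · x , ψ i ⟩) • ψ i))
mainTheorem6 N U U-unitary S F s ∥BD̄∥≡s s<1 ψ σ² ψ⊥ Bψ BDBψ = σ²≠0 , reconstruct σ²≠0
  where
  open BandLimiting U F
  open HermitianSampling (bandLimiting U F) (indicatorMatrix S) bandLimiting-hermitian
    (diagonal-hermitian (indicator S) (indicator-selfAdjoint S)) (frobenius-bandLimiting U-unitary)
    ψ σ² ψ⊥ Bψ BDBψ
  σ²≠0 : ∀ i → NonZeroℂ (σ² i)
  σ²≠0 = eigenvalue-nonZero s ∥BD̄∥≡s s<1
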